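{- Let $G=(V,E)$ be a locally finite simple graph and $x\in V$ be an $S_1$-out regular vertex of degree $d\ge2$. Let $\Delta_{S_1''(x)}$ be the weighted Laplacian on $S_1(x)$ with weights $w''$, with second-smallest eigenvalue $\lambda_1=\lambda_1(\Delta_{S_1''(x)})$. (a) The case $\lambda_1\ge\frac d2$ is equivalent to $\infty$-curvature sharpness of $x$. In this case, for all $\mathcal N\in(0,\infty]$, $$\mathcal K_{G,x}(\mathcal N)=\frac{3+d-av_1^+(x)}2-\frac{2d}{\mathcal N}.$$ (b) If $\lambda_1<\frac d2$, then for all $\mathcal N\in(0,\infty]$, $$\mathcal K_{G,x}(\mathcal N)=\begin{cases}\frac{3+d-av_1^+(x)}2-\frac{2d}{\mathcal N},&\text{if }\mathcal N\le\frac{2d}{d-2\lambda_1},\\[1mm]\frac{3-d-av_1^+(x)}2+2\lambda_1,&\text{if }\mathcal N>\frac{2d}{d-2\lambda_1}.\end{cases}$$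
   Context: Graphs are undirected, without loops or multiple edges, and every vertex has finite degree. For $f:V\to\mathbb R$ put $\Delta f(x)=\sum_{y\sim x}(f(y)-f(x))$ (non-normalized Laplacian), and for $f,g:V\to\mathbb R$ put $2\Gamma(f,g)=\Delta(fg)-f\Delta g-g\Delta f$, $2\Gamma_2(f,g)=\Delta\Gamma(f,g)-\Gamma(f,\Delta g)-\Gamma(\Delta f,g)$, $\Gamma(f)=\Gamma(f,f)$, $\Gamma_2(f)=\Gamma_2(f,f)$. For $\mathcal N\in(0,\infty]$ (convention $1/\infty=0$), $\mathcal K_{G,x}(\mathcal N)$ is the largest $K\in\mathbb R$ such that $\Gamma_2(f)(x)\ge\frac1{\mathcal N}(\Delta f(x))^2+K\,\Gamma(f)(x)$ for all $f:V\to\mathbb R$ (Bakry-Émery curvature function). $S_r(x)$ is the set of vertices at graph distance $r$ from $x$; $S_1(x)=\{y_1,\dots,y_d\}$. For $y\in S_1(x)$, the out degree $d_y^+$ is the number of neighbours of $y$ in $S_2(x)$; for $z\in S_2(x)$, $d_z^-$ is the number of neighbours of $z$ in $S_1(x)$; $av_1^+(x)=\frac1d\sum_{y\in S_1(x)}d_y^+$. The vertex $x$ is $S_1$-out regular if all $y\in S_1(x)$ have the same out degree. The vertex $x$ is $\infty$-curvature sharp if $\mathcal K_{G,x}(\infty)=\frac{3+d-av_1^+(x)}2$. Let $w_{uv}=1$ if $u\sim v$ in $G$ and $0$ otherwise. For $i\ne j$ put $w'_{y_iy_j}=\sum_{z\in S_2(x)}\frac{w_{y_iz}w_{zy_j}}{d_z^-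 }$ and $w''_{y_iy_j}=w_{y_iy_j}+w'_{y_iy_j}$. The weighted Laplacian $\Delta_{S_1''(x)}$ acts on functions $f:S_1(x)\to\mathbb R$ by $\Delta_{S_1''(x)}f(y_i)=\sum_{j\ne i}w''_{y_iy_j}(f(y_j)-f(y_i))$. Its eigenvalues are the $\lambda$ with $\Delta_{S_1''(x)}f+\lambda f=0$ for some $f\neq0$, ordered with multiplicity as $0=\lambda_0\le\lambda_1\le\dots\le\lambda_{d-1}$. -}

module Defs where

open import Algebra.Bundles using (CommutativeRing)
open import Axiom.ExcludedMiddle using (ExcludedMiddle)
open import Data.Bool.Base using (if_then_else_)
open import Data.Fin.Base as Fin using (Fin)
import Data.Fin.Properties as Fin
open import Data.List.Base using (List; length; lookup; filter; deduplicate; concatMap; allFin)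
open import Data.List.Membership.Propositional using (_∈_)
open import Data.List.Relation.Unary.Unique.Propositional using (Unique)
open import Data.Nat.Base as ℕ using (ℕ; zero; suc)
open import Data.Product.Base using (∃; ∃-syntax; _×_)
open import Data.Vec.Functional using (Vector)
open import Function.Bundles using (_⇔_)
open import Level using (0ℓ)
open import Relation.Binary.Core using (Rel)
open import Relation.Binary.Definitions using (Symmetric; Irreflexive)
open import Relation.Binary.PropositionalEquality.Core using (_≡_)
open import Relation.Binary.Structures using (IsTotalOrder)
open import Relation.Nullary.Decidable.Core using (does)
open import Relation.Nullary.Negation.Core using (¬_)
open import Relation.Nullary.Construct.Add.Supremum using (_⁺; ⊤⁺; [_])
import Relation.Binary.Construct.NonStrictToStrict as ToStrict
import Relation.Binary.Construct.Add.Supremum.NonStrict as SupremumNonStrict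
import Relation.Binary.Construct.Add.Supremum.Strict as SupremumStrict
import Algebra.Properties.Monoid.Sum as Sum
import Algebra.Properties.Monoid.Mult as Mult

-- The real numbers, given by their characterisation (up to unique
-- isomorphism, in classical logic) as the Dedekind-complete ordered field.
-- Equality is a setoid equality.  The value of 0# ⁻¹ is left unspecified.
record CompleteOrderedField : Set₁ where
  infix  8 _⁻¹
  infixl 7 _/_
  infix  4 _≤_

  field
    commutativeRing : CommutativeRing 0ℓ 0ℓ

  open CommutativeRing commutativeRing public renaming (Carrier to ℝ)

  field
    _≤_          : Rel ℝ 0ℓ
    isTotalOrder : IsTotalOrder _≈_ _≤_
    +-monoˡ-≤    : ∀ z {x y} → x ≤ y → x + z ≤ y + z
    *-nonNeg     : ∀ {x y} → 0# ≤ x → 0# ≤ y → 0# ≤ x * y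
    _⁻¹          : ℝ → ℝ
    ⁻¹-cong      : ∀ {x y} → x ≈ y → x ⁻¹ ≈ y ⁻¹
    ⁻¹-inverseʳ  : ∀ x → ¬ (x ≈ 0#) → x * x ⁻¹ ≈ 1#
    0≉1          : ¬ (0# ≈ 1#)

  IsUpperBound : (ℝ → Set) → ℝ → Set
  IsUpperBound P b = ∀ x → P x → x ≤ b

  field
    complete : (P : ℝ → Set) → ∃ P → ∃ (IsUpperBound P) →
               ∃[ s ] IsUpperBound P s × (∀ b → IsUpperBound P b → s ≤ b)

  open ToStrict _≈_ _≤_ public using (_<_)
  open SupremumNonStrict _≤_ public using (_≤⁺_)
  open SupremumStrict _<_ public using (_<⁺_)
  private module Mult+ = Mult +-monoid
  open Sum +-monoid public using (sum)

  _/_ : ℝ → ℝ → ℝ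
  x / y = x * y ⁻¹

  ι : ℕ → ℝ
  ι n = n Mult+.× 1#

  IsGreatest : (ℝ → Set) → ℝ → Set
  IsGreatest P m = P m × IsUpperBound P m

record LocallyFiniteGraph : Set₁ where
  infix 4 _~_
  field
    V         : Set
    _~_       : Rel V 0ℓ
    ~-sym     : Symmetric _~_
    ~-irrefl  : Irreflexive _≡_ _~_
    nbrs      : V → List V
    nbrs-uniq : ∀ v → Unique (nbrs v)
    ∈-nbrs    : ∀ {u v} → v ∈ nbrs u ⇔ u ~ v

  data Walk : ℕ → V → V → Set where
    nil  : ∀ {u} → Walk zero u u
    cons : ∀ {n u v w} → u ~ v → Walk n v w → Walk (suc n) u w

  -- S r u v : the graph distance from u to v is r.
  S : ℕ → V → V → Set
  S r u v = Walk r u v × (∀ k → k ℕ.< r → ¬ Walk k u v)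

-- Excluded middle decides adjacency, membership in spheres and equality, so
-- that the finite counts and indicators below can be formed.
module Curvature (em : ExcludedMiddle 0ℓ) (R : CompleteOrderedField)
                 (G : LocallyFiniteGraph) where
  open CompleteOrderedField R
  open LocallyFiniteGraph G

  sumOver : List V → (V → ℝ) → ℝ
  sumOver vs f = sum (λ i → f (lookup vs i))

  Δ : (V → ℝ) → V → ℝ
  Δ f u = sumOver (nbrs u) (λ v → f v - f u)

  Γ : (V → ℝ) → (V → ℝ) → V → ℝ
  Γ f g u = (Δ (λ v → f v * g v) u - f u * Δ g u - g u * Δ f u) / ι 2

  Γ₂ : (V → ℝ) → (V → ℝ) → V → ℝ
  Γ₂ f g u = (Δ (Γ f g) u - Γ f (Δ g) u - Γ (Δ f) g u) / ι 2

  -- ℝ ⁺ adjoins ⊤⁺ = ∞ to ℝ.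
  recip : ℝ ⁺ → ℝ
  recip [ N ] = N ⁻¹
  recip ⊤⁺    = 0#

  CD : V → ℝ ⁺ → ℝ → Set
  CD x 𝒩 K = ∀ (f : V → ℝ) →
    recip 𝒩 * (Δ f x * Δ f x) + K * Γ f f x ≤ Γ₂ f f x

  -- IsCurvature x 𝒩 κ : the curvature function of G at x takes the value κ at 𝒩.
  IsCurvature : V → ℝ ⁺ → ℝ → Set
  IsCurvature x 𝒩 = IsGreatest (CD x 𝒩)

  module AtVertex (x : V) where

    d : ℕ
    d = length (nbrs x)

    -- The vertices y₁, …, y_d of the sphere of radius 1, i.e. the neighbours of x.
    y : Fin d → V
    y = lookup (nbrs x)

    -- Every vertex at distance 2 is a neighbour of a neighbour.
    S₂ : List V
    S₂ = filter (λ z → em {S 2 x z})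
                (deduplicate (λ u v → em {u ≡ v}) (concatMap nbrs (nbrs x)))

    d⁺ : V → ℕ
    d⁺ u = length (filter (λ z → em {S 2 x z}) (nbrs u))

    d⁻ : V → ℕ
    d⁻ z = length (filter (λ u → em {S 1 x u}) (nbrs z))

    av₁⁺ : ℝ
    av₁⁺ = sum (λ i → ι (d⁺ (y i))) / ι d

    S₁-OutRegular : Set
    S₁-OutRegular = ∀ i j → d⁺ (y i) ≡ d⁺ (y j)

    ∞-CurvatureSharp : Set
    ∞-CurvatureSharp = IsCurvature x ⊤⁺ ((ι 3 + ι d - av₁⁺) / ι 2)

    w : V → V → ℝ
    w u v = if does (em {u ~ v}) then 1# else 0#

    w′ : Fin d → Fin d → ℝ
    w′ i j = sumOver S₂ (λ z → (w (y i) z * w z (y j)) / ι (d⁻ z))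

    w″ : Fin d → Fin d → ℝ
    w″ i j = w (y i) (y j) + w′ i j

    -- A function on the sphere of radius 1 is a vector indexed by 1, …, d.
    Δ″ : Vector ℝ d → Vector ℝ d
    Δ″ f i = sum (λ j → if does (i Fin.≟ j) then 0# else w″ i j * (f j - f i))

    Eigenspace : ℝ → Vector ℝ d → Set
    Eigenspace μ f = ∀ i → Δ″ f i + μ * f i ≈ 0#

    combination : ∀ {m} → Vector ℝ m → Vector (Vector ℝ d) m → Vector ℝ d
    combination c b i = sum (λ k → c k * b k i)

    record HasDimension (E : Vector ℝ d → Set) (m : ℕ) : Set where
      field
        basis       : Vector (Vector ℝ d) m
        member      : ∀ k → E (basis k)
        independent : ∀ c → (∀ i → combination c basis i ≈ 0#) → ∀ k → c k ≈ 0#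
        spanning    : ∀ f → E f → ∃[ c ] ∀ i → f i ≈ combination c basis i

    -- The eigenvalues of Δ″ in increasing order, each repeated according to
    -- its multiplicity, i.e. the dimension of its eigenspace (which is 0
    -- when μ is not an eigenvalue).
    record IsSpectrum (λs : Vector ℝ d) : Set where
      field
        ordered      : ∀ i j → i Fin.≤ j → λs i ≤ λs j
        multiplicity : ∀ μ → HasDimension (Eigenspace μ)
                         (length (filter (λ i → em {λs i ≈ μ}) (allFin d)))

{-# OPTIONS --safe #-}

-- Write aᵢ = f(yᵢ) - f(x) and D = av₁⁺.  Expanding Γ₂ at x and completing squares
-- in the values of f on S₂(x) gives
--   4Γ₂(f)(x) = (3 - d - D)|a|² + 2(Σaᵢ)² - 4⟨a, Δ″a⟩
--               + Σ_{z ∈ S₂(x)} d⁻(z) (f(z) - f(x) - 2 mean_{yᵢ ~ z} aᵢ)²,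
-- while 2Γ(f)(x) = |a|² and Δf(x) = Σaᵢ.  As the values on S₂(x) are free, the
-- curvature-dimension inequality is the nonnegativity of a quadratic form in a which is
-- diagonal in an eigenbasis of Δ″ containing the constants: the constants and the
-- eigenfunctions of λ₁ give two upper bounds on K, and these are sufficient.  The
-- curvature is the smaller of the two, and comparing them yields the theorem.
module Submission where

open import Defs
open import Algebra.Bundles using (CommutativeRing)
import Algebra.Properties.AbelianGroup
import Algebra.Properties.Group
import Algebra.Properties.Ring
import Algebra.Properties.Semiring.Mult
import Algebra.Properties.Semiring.Sum
import Algebra.Solver.Ring
open import Algebra.Solver.Ring.AlmostCommutativeRing
  using (fromCommutativeRing; _-Raw-AlmostCommutative⟶_)
open import Axiom.ExcludedMiddle using (ExcludedMiddle)
open import Data.Bool.Base using (if_then_else_)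
open import Data.Fin.Base using (Fin; zero; suc; toℕ; fromℕ<)
import Data.Fin.Properties as Fin
open import Data.Integer.Base as ℤ using (ℤ; +_; -[1+_]; _⊖_)
import Data.Integer.Properties as ℤ
open import Data.List.Base
  using (List; []; _∷_; _++_; length; lookup; filter; deduplicate; concatMap; allFin)
open import Data.List.Membership.Propositional using (_∈_; lose)
open import Data.List.Membership.Propositional.Properties
  using (∈-lookup; ∈-filter⁺; ∈-filter⁻; ∈-deduplicate⁺; ∈-concatMap⁺; ∈-++⁺ˡ; ∈-++⁺ʳ; ∈-++⁻; ∈-allFin)
open import Data.List.Membership.Propositional.Properties.WithK using (unique∧set⇒bag)
open import Data.List.Properties using (filter-≐)
open import Data.List.Relation.Binary.BagAndSetEquality using (∼bag⇒↭)
open import Data.List.Relation.Binary.Permutation.Propositional as Perm using (_↭_)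
open import Data.List.Relation.Unary.All as All using ()
open import Data.List.Relation.Unary.AllPairs using (_∷_)
open import Data.List.Relation.Unary.Any as Any using (here; there)
open import Data.List.Relation.Unary.Any.Properties using (lookup-index)
import Data.List.Relation.Unary.Unique.DecPropositional.Properties as UniqueDec
open import Data.List.Relation.Unary.Unique.Propositional using (Unique)
import Data.List.Relation.Unary.Unique.Propositional.Properties as Unique
open import Data.Maybe.Base using (Maybe; just; nothing)
open import Data.Nat.Base as ℕ using (ℕ; zero; suc; s≤s; z≤n)
import Data.Nat.Properties as ℕ
open import Data.Product.Base using (∃-syntax; _×_; _,_; proj₁; proj₂)
open import Data.Sum.Base using (_⊎_; inj₁; inj₂)
open import Data.Vec.Functional using (Vector) renaming (_∷_ to _∷ᵥ_)
open import Function.Base using (_∘_)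
open import Function.Bundles using (_⇔_; Equivalence; mk⇔)
open import Level using (0ℓ)
import Relation.Binary.Construct.Add.Supremum.NonStrict as SupremumNonStrict
import Relation.Binary.Construct.Add.Supremum.Strict as SupremumStrict
open import Relation.Binary.PropositionalEquality.Core as ≡ using (_≡_; _≢_)
open import Relation.Binary.Structures using (IsTotalOrder)
open import Relation.Nullary.Construct.Add.Supremum using (_⁺; ⊤⁺; [_])
open import Relation.Nullary.Decidable.Core using (yes; no; does)
open import Relation.Nullary.Negation.Core using (¬_; contradiction)

-- A function on S₁(x) with zero sum does not contribute to `Δ f x`, so 𝒩 enters only through the
-- constants. Hence the bound from λ₁ does not depend on 𝒩, and the curvature grows in 𝒩 until it
-- reaches that bound and then stays there. Eigenvalues above λ₁ give only weaker constraints.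
-- Out-regularity is what makes the form diagonal. The squares over S₂(x) leave the terms
-- -d⁺(yᵢ)aᵢ², which add up to a multiple of |a|² when all out degrees agree; in general they need
-- not commute with Δ″. The spectrum is given only by the dimensions of eigenspaces. Most of the
-- linear algebra turns these into d mutually orthogonal eigenfunctions and shows, by counting, that
-- they span. The delicate case is λ₁ = 0: then the eigenfunctions chosen for λ₀ and λ₁ need be
-- neither constant nor of zero sum, and both the lower bound on the form and the test function
-- attaining it need separate arguments.

-- Polynomial identities with integer coefficients.

module IntegerCoefficients {c ℓ} (R : CommutativeRing c ℓ) where
  open CommutativeRing R hiding (zero)
  open Algebra.Properties.Semiring.Mult semiring using (×-homo-+; ×1-homo-*) renaming (_×_ to _·_)
  open Algebra.Properties.Ring ring using (-‿distribˡ-*)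
  open Algebra.Properties.AbelianGroup +-abelianGroup using (⁻¹-∙-comm)
  open Algebra.Properties.Group +-group
    using () renaming (ε⁻¹≈ε to -0#≈0#; ⁻¹-involutive to -‿involutive)
  open import Relation.Binary.Reasoning.Setoid setoid

  -- Coefficients are integers because their equality is decidable. With this interpretation
  -- `con (+ n)` evaluates to `ι n` definitionally, so numerals such as `ι 2` match the solver's
  -- constants without rewriting.
  ⟦_⟧ℤ : ℤ → Carrier
  ⟦ + n      ⟧ℤ = n · 1#
  ⟦ -[1+ n ] ⟧ℤ = - (suc n · 1#)

  ⊖-homo : ∀ m n → ⟦ m ⊖ n ⟧ℤ ≈ m · 1# - n · 1#
  ⊖-homo m       zero    = sym (trans (+-congˡ -0#≈0#) (+-identityʳ _))
  ⊖-homo zero    (suc n) = sym (+-identityˡ _)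
  ⊖-homo (suc m) (suc n) = begin
    ⟦ suc m ⊖ suc n ⟧ℤ                ≡⟨ ≡.cong ⟦_⟧ℤ (ℤ.[1+m]⊖[1+n]≡m⊖n m n) ⟩
    ⟦ m ⊖ n ⟧ℤ                        ≈⟨ ⊖-homo m n ⟩
    a - b                             ≈⟨ +-congʳ (+-identityʳ a) ⟨
    (a + 0#) - b                      ≈⟨ +-congʳ (+-congˡ (-‿inverseʳ 1#)) ⟨
    (a + (1# - 1#)) - b               ≈⟨ +-congʳ (+-assoc a 1# _) ⟨
    ((a + 1#) - 1#) - b               ≈⟨ +-assoc _ _ _ ⟩
    (a + 1#) + (- 1# - b)             ≈⟨ +-cong (+-comm a 1#) (⁻¹-∙-comm 1# b) ⟩
    (1# + a) - (1# + b)               ∎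
    where a = m · 1# ; b = n · 1#

  -‿homoℤ : ∀ i → ⟦ ℤ.- i ⟧ℤ ≈ - ⟦ i ⟧ℤ
  -‿homoℤ (+ zero)   = sym -0#≈0#
  -‿homoℤ (+ suc n)  = refl
  -‿homoℤ (-[1+ n ]) = sym (-‿involutive _)

  +-homoℤ : ∀ i j → ⟦ i ℤ.+ j ⟧ℤ ≈ ⟦ i ⟧ℤ + ⟦ j ⟧ℤ
  +-homoℤ (+ m)      (+ n)      = ×-homo-+ 1# m n
  +-homoℤ (+ m)      (-[1+ n ]) = ⊖-homo m (suc n)
  +-homoℤ (-[1+ m ]) (+ n)      = trans (⊖-homo n (suc m)) (+-comm _ _)
  +-homoℤ (-[1+ m ]) (-[1+ n ]) = begin
    ⟦ -[1+ m ] ℤ.+ -[1+ n ] ⟧ℤ            ≡⟨ ≡.cong ⟦_⟧ℤ (≡.sym (ℤ.neg-distrib-+ (+ suc m) (+ suc n))) ⟩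
    ⟦ ℤ.- (+ suc m ℤ.+ + suc n) ⟧ℤ        ≈⟨ -‿homoℤ (+ suc m ℤ.+ + suc n) ⟩
    - ⟦ + suc m ℤ.+ + suc n ⟧ℤ            ≈⟨ -‿cong (×-homo-+ 1# (suc m) (suc n)) ⟩
    - (suc m · 1# + suc n · 1#)           ≈⟨ ⁻¹-∙-comm _ _ ⟨
    - (suc m · 1#) - suc n · 1#           ∎

  *-homo-posˡ : ∀ m j → ⟦ + m ℤ.* j ⟧ℤ ≈ m · 1# * ⟦ j ⟧ℤ
  *-homo-posˡ m (+ n) = begin
    ⟦ + m ℤ.* + n ⟧ℤ  ≡⟨ ≡.cong ⟦_⟧ℤ (≡.sym (ℤ.pos-* m n)) ⟩
    (m ℕ.* n) · 1#    ≈⟨ ×1-homo-* m n ⟩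
    m · 1# * n · 1#   ∎
  *-homo-posˡ m (-[1+ n ]) = begin
    ⟦ + m ℤ.* -[1+ n ] ⟧ℤ        ≡⟨ ≡.cong ⟦_⟧ℤ (≡.sym (ℤ.neg-distribʳ-* (+ m) (+ suc n))) ⟩
    ⟦ ℤ.- (+ m ℤ.* + suc n) ⟧ℤ   ≈⟨ -‿homoℤ (+ m ℤ.* + suc n) ⟩
    - ⟦ + m ℤ.* + suc n ⟧ℤ       ≈⟨ -‿cong (*-homo-posˡ m (+ suc n)) ⟩
    - (m · 1# * suc n · 1#)      ≈⟨ -‿cong (*-comm _ _) ⟩
    - (suc n · 1# * m · 1#)      ≈⟨ -‿distribˡ-* _ _ ⟩
    - (suc n · 1#) * m · 1#      ≈⟨ *-comm _ _ ⟩
    m · 1# * - (suc n · 1#)      ∎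

  *-homoℤ : ∀ i j → ⟦ i ℤ.* j ⟧ℤ ≈ ⟦ i ⟧ℤ * ⟦ j ⟧ℤ
  *-homoℤ (+ m)      j = *-homo-posˡ m j
  *-homoℤ (-[1+ m ]) j = begin
    ⟦ -[1+ m ] ℤ.* j ⟧ℤ        ≡⟨ ≡.cong ⟦_⟧ℤ (≡.sym (ℤ.neg-distribˡ-* (+ suc m) j)) ⟩
    ⟦ ℤ.- (+ suc m ℤ.* j) ⟧ℤ   ≈⟨ -‿homoℤ (+ suc m ℤ.* j) ⟩
    - ⟦ + suc m ℤ.* j ⟧ℤ       ≈⟨ -‿cong (*-homo-posˡ (suc m) j) ⟩
    - (suc m · 1# * ⟦ j ⟧ℤ)    ≈⟨ -‿distribˡ-* _ _ ⟩
    - (suc m · 1#) * ⟦ j ⟧ℤ    ∎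

  ℤ⟶R : ℤ.+-*-rawRing -Raw-AlmostCommutative⟶ fromCommutativeRing R
  ℤ⟶R = record
    { ⟦_⟧    = ⟦_⟧ℤ
    ; +-homo = +-homoℤ
    ; *-homo = *-homoℤ
    ; -‿homo = -‿homoℤ
    ; 0-homo = refl
    ; 1-homo = +-identityʳ 1#
    }

  coefficient≟ : ∀ i j → Maybe (⟦ i ⟧ℤ ≈ ⟦ j ⟧ℤ)
  coefficient≟ i j with i ℤ.≟ j
  ... | yes ≡.refl = just refl
  ... | no _       = nothing

  open Algebra.Solver.Ring ℤ.+-*-rawRing (fromCommutativeRing R) ℤ⟶R coefficient≟ public
    using (solve; _:=_; _:+_; _:*_; _:-_; :-_; con)

-- Inequalities in an ordered field and finite sums.

module OrderedField (R : CompleteOrderedField) where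
  open CompleteOrderedField R hiding (zero)
  open IntegerCoefficients commutativeRing
    using (solve; _:=_; _:+_; _:*_; _:-_; :-_; con)
  open Algebra.Properties.Semiring.Sum semiring
    using (sum-cong-≋; sum-replicate-zero; ∑-distrib-+; ∑-comm; *-distribˡ-sum)
  open IsTotalOrder isTotalOrder public using ()
    renaming (reflexive to ≤-reflexive; trans to ≤-trans; antisym to ≤-antisym; total to ≤-total;
      ≤-respˡ-≈ to ≤-respˡ; ≤-respʳ-≈ to ≤-respʳ)
  open import Relation.Binary.Reasoning.Setoid setoid

  ≤⇒0≤- : ∀ {x y} → x ≤ y → 0# ≤ y - x
  ≤⇒0≤- {x} x≤y = ≤-respˡ (-‿inverseʳ x) (+-monoˡ-≤ (- x) x≤y)

  0≤-⇒≤ : ∀ {x y} → 0# ≤ y - x → x ≤ y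
  0≤-⇒≤ {x} {y} h = ≤-respˡ (+-identityˡ x)
    (≤-respʳ (solve 2 (λ x y → (y :- x) :+ x := y) refl x y) (+-monoˡ-≤ x h))

  0≤+ : ∀ {x y} → 0# ≤ x → 0# ≤ y → 0# ≤ x + y
  0≤+ {x} {y} 0≤x 0≤y =
    ≤-trans 0≤y (≤-respˡ (+-identityˡ y) (+-monoˡ-≤ y 0≤x))

  ≤0⇒0≤- : ∀ {x} → x ≤ 0# → 0# ≤ - x
  ≤0⇒0≤- {x} h = ≤-respʳ (+-identityˡ (- x)) (≤⇒0≤- h)

  0≤-⇒≤0 : ∀ {x} → 0# ≤ - x → x ≤ 0#
  0≤-⇒≤0 {x} h = 0≤-⇒≤ (≤-respʳ (sym (+-identityˡ (- x))) h)

  0≤x*x : ∀ x → 0# ≤ x * x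
  0≤x*x x with ≤-total 0# x
  ... | inj₁ 0≤x = *-nonNeg 0≤x 0≤x
  ... | inj₂ x≤0 = ≤-respʳ (solve 1 (λ x → :- x :* :- x := x :* x) refl x)
                           (*-nonNeg (≤0⇒0≤- x≤0) (≤0⇒0≤- x≤0))

  0≤1 : 0# ≤ 1#
  0≤1 = ≤-respʳ (*-identityˡ 1#) (0≤x*x 1#)

  0≤ι : ∀ n → 0# ≤ ι n
  0≤ι zero    = ≤-reflexive refl
  0≤ι (suc n) = 0≤+ 0≤1 (0≤ι n)

  1≤ι[1+n] : ∀ n → 1# ≤ ι (suc n)
  1≤ι[1+n] n = 0≤-⇒≤ (≤-respʳ (solve 2 (λ e m → m := (e :+ m) :- e) refl 1# (ι n)) (0≤ι n))

  -- Characteristic zero follows from the order: vanishing would give `1# ≤ 0#`, contradicting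
  -- `0≉1`.
  ι[1+n]≉0 : ∀ n → ¬ (ι (suc n) ≈ 0#)
  ι[1+n]≉0 n eq = 0≉1 (≤-antisym 0≤1 (≤-respʳ eq (1≤ι[1+n] n)))

  ⁻¹-inverseˡ : ∀ x → ¬ (x ≈ 0#) → x ⁻¹ * x ≈ 1#
  ⁻¹-inverseˡ x x≉0 = trans (*-comm _ _) (⁻¹-inverseʳ x x≉0)

  *-/-cancel : ∀ x {y} → ¬ (y ≈ 0#) → y * (x / y) ≈ x
  *-/-cancel x {y} y≉0 = begin
    y * (x * y ⁻¹)   ≈⟨ solve 3 (λ x y z → y :* (x :* z) := x :* (y :* z)) refl x y (y ⁻¹) ⟩
    x * (y * y ⁻¹)   ≈⟨ *-congˡ (⁻¹-inverseʳ y y≉0) ⟩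
    x * 1#           ≈⟨ *-identityʳ x ⟩
    x                ∎

  *-cancelˡ-≈0 : ∀ {c x} → ¬ (c ≈ 0#) → c * x ≈ 0# → x ≈ 0#
  *-cancelˡ-≈0 {c} {x} c≉0 eq = begin
    x               ≈⟨ *-/-cancel x c≉0 ⟨
    c * (x * c ⁻¹)  ≈⟨ *-assoc c x _ ⟨
    c * x * c ⁻¹    ≈⟨ *-congʳ eq ⟩
    0# * c ⁻¹       ≈⟨ zeroˡ _ ⟩
    0#              ∎

  -- If `x ≤ 0#`, then `c * x` is squeezed to zero and so is `x`. The positivity of `c ⁻¹` is not
  -- presupposed, so that `0≤⁻¹` can be derived from this lemma.
  *-cancelˡ-0≤ : ∀ {c x} → 0# < c → 0# ≤ c * x → 0# ≤ x
  *-cancelˡ-0≤ {c} {x} (0≤c , 0≉c) h with ≤-total 0# x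
  ... | inj₁ 0≤x = 0≤x
  ... | inj₂ x≤0 = ≤-reflexive (sym (*-cancelˡ-≈0 (0≉c ∘ sym) (≤-antisym cx≤0 h)))
    where
    cx≤0 : c * x ≤ 0#
    cx≤0 = 0≤-⇒≤0 (≤-respʳ (solve 2 (λ c x → c :* :- x := :- (c :* x)) refl c x)
                           (*-nonNeg 0≤c (≤0⇒0≤- x≤0)))

  0<ι[1+n] : ∀ n → 0# < ι (suc n)
  0<ι[1+n] n = 0≤ι (suc n) , ι[1+n]≉0 n ∘ sym

  0<ι : ∀ {n} → Fin n → 0# < ι n
  0<ι {suc n} _ = 0<ι[1+n] n

  0≤⁻¹ : ∀ {x} → 0# < x → 0# ≤ x ⁻¹
  0≤⁻¹ {x} 0<x@(_ , 0≉x) = *-cancelˡ-0≤ 0<x (≤-respʳ (sym (⁻¹-inverseʳ x (0≉x ∘ sym))) 0≤1)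

  ≉0⇒0< : ∀ {x} → 0# ≤ x → ¬ (x ≈ 0#) → 0# < x
  ≉0⇒0< h n = h , n ∘ sym

  x-x≈0⇒x≈y : ∀ {x y} → x - y ≈ 0# → x ≈ y
  x-x≈0⇒x≈y {x} {y} eq = begin
    x            ≈⟨ solve 2 (λ x y → x := (x :- y) :+ y) refl x y ⟩
    (x - y) + y  ≈⟨ +-congʳ eq ⟩
    0# + y       ≈⟨ +-identityˡ y ⟩
    y            ∎

  *-cancelˡ-≈ : ∀ {c x y} → ¬ (c ≈ 0#) → c * x ≈ c * y → x ≈ y
  *-cancelˡ-≈ {c} {x} {y} c≉0 eq = x-x≈0⇒x≈y (*-cancelˡ-≈0 c≉0 (begin
    c * (x - y)      ≈⟨ solve 3 (λ c x y → c :* (x :- y) := c :* x :- c :* y) refl c x y ⟩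
    c * x - c * y    ≈⟨ +-congʳ eq ⟩
    c * y - c * y    ≈⟨ -‿inverseʳ _ ⟩
    0#               ∎))

  sum-cong : ∀ {n} {f g : Vector ℝ n} → (∀ i → f i ≈ g i) → sum f ≈ sum g
  sum-cong = sum-cong-≋

  sum-zero : ∀ {n} {f : Vector ℝ n} → (∀ i → f i ≈ 0#) → sum f ≈ 0#
  sum-zero {n} h = trans (sum-cong h) (sum-replicate-zero n)

  sum-+ : ∀ {n} (f g : Vector ℝ n) → sum (λ i → f i + g i) ≈ sum f + sum g
  sum-+ = ∑-distrib-+

  sum-* : ∀ {n} c (f : Vector ℝ n) → sum (λ i → c * f i) ≈ c * sum f
  sum-* c f = sym (*-distribˡ-sum c f)

  sum-neg : ∀ {n} (f : Vector ℝ n) → sum (λ i → - f i) ≈ - sum f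
  sum-neg {zero}  f = solve 0 (con (+ 0) := :- con (+ 0)) refl
  sum-neg {suc n} f = trans (+-congˡ (sum-neg (f ∘ suc)))
    (solve 2 (λ a b → :- a :- b := :- (a :+ b)) refl _ _)

  sum-minus : ∀ {n} (f g : Vector ℝ n) → sum (λ i → f i - g i) ≈ sum f - sum g
  sum-minus f g = trans (sum-+ f (λ i → - g i)) (+-congˡ (sum-neg g))

  sum-const : ∀ n c → sum {n} (λ _ → c) ≈ ι n * c
  sum-const zero    c = sym (zeroˡ c)
  sum-const (suc n) c = begin
    c + sum {n} (λ _ → c)  ≈⟨ +-cong (sym (*-identityˡ c)) (sum-const n c) ⟩
    1# * c + ι n * c       ≈⟨ distribʳ c 1# (ι n) ⟨
    (1# + ι n) * c         ∎

  sum-swap : ∀ {m n} (f : Fin m → Fin n → ℝ) →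
             sum (λ i → sum (λ j → f i j)) ≈ sum (λ j → sum (λ i → f i j))
  sum-swap = ∑-comm

  sum-single : ∀ {n} (f : Vector ℝ n) i → (∀ j → j ≢ i → f j ≈ 0#) → sum f ≈ f i
  sum-single f zero    h = trans (+-congˡ (sum-zero λ j → h (suc j) λ ())) (+-identityʳ _)
  sum-single f (suc i) h = trans
    (+-cong (h zero λ ()) (sum-single (f ∘ suc) i λ j j≢i → h (suc j) λ { ≡.refl → j≢i ≡.refl }))
    (+-identityˡ _)

  0≤sum : ∀ {n} {f : Vector ℝ n} → (∀ i → 0# ≤ f i) → 0# ≤ sum f
  0≤sum {zero}  h = ≤-reflexive refl
  0≤sum {suc n} h = 0≤+ (h zero) (0≤sum (h ∘ suc))

  +≈0⇒≈0 : ∀ {x y} → 0# ≤ x → 0# ≤ y → x + y ≈ 0# → x ≈ 0#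
  +≈0⇒≈0 {x} {y} 0≤x 0≤y eq = ≤-antisym (≤-respʳ eq x≤x+y) 0≤x
    where
    x≤x+y : x ≤ x + y
    x≤x+y = 0≤-⇒≤ (≤-respʳ (solve 2 (λ x y → y := (x :+ y) :- x) refl x y) 0≤y)

  sum≈0⇒≈0 : ∀ {n} {f : Vector ℝ n} → (∀ i → 0# ≤ f i) → sum f ≈ 0# → ∀ i → f i ≈ 0#
  sum≈0⇒≈0 h eq zero    = +≈0⇒≈0 (h zero) (0≤sum (h ∘ suc)) eq
  sum≈0⇒≈0 h eq (suc i) = sum≈0⇒≈0 (h ∘ suc)
    (+≈0⇒≈0 (0≤sum (h ∘ suc)) (h zero) (trans (+-comm _ _) eq)) i

-- Orthogonal systems: Gram-Schmidt and completeness.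

module LinearAlgebra (em : ExcludedMiddle 0ℓ) (R : CompleteOrderedField) where
  open CompleteOrderedField R hiding (zero)
  open OrderedField R
  open IntegerCoefficients commutativeRing
    using (solve; _:=_; _:+_; _:*_; _:-_; :-_; con)
  open import Relation.Binary.Reasoning.Setoid setoid

  x*x≈0⇒x≈0 : ∀ {x} → x * x ≈ 0# → x ≈ 0#
  x*x≈0⇒x≈0 {x} eq with em {x ≈ 0#}
  ... | yes x≈0 = x≈0
  ... | no x≉0  = *-cancelˡ-≈0 x≉0 eq

  infix 8 _∙_
  _∙_ : ∀ {n} → Vector ℝ n → Vector ℝ n → ℝ
  f ∙ g = sum (λ i → f i * g i)

  Σ⟨_,_⟩ : ∀ {m n} → Vector ℝ m → Vector (Vector ℝ n) m → Vector ℝ n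
  Σ⟨ c , b ⟩ i = sum (λ k → c k * b k i)

  ∙-cong : ∀ {n} {f f′ g g′ : Vector ℝ n} → (∀ i → f i ≈ f′ i) → (∀ i → g i ≈ g′ i) →
           f ∙ g ≈ f′ ∙ g′
  ∙-cong p q = sum-cong (λ i → *-cong (p i) (q i))

  ∙-comm : ∀ {n} (f g : Vector ℝ n) → f ∙ g ≈ g ∙ f
  ∙-comm f g = sum-cong (λ i → *-comm (f i) (g i))

  ∙-linearˡ : ∀ {n} c (f g h : Vector ℝ n) → (λ i → f i + c * g i) ∙ h ≈ f ∙ h + c * g ∙ h
  ∙-linearˡ {n} c f g h = begin
    sum (λ i → (f i + c * g i) * h i)
      ≈⟨ sum-cong (λ i → solve 4 (λ f c g h → (f :+ c :* g) :* h := f :* h :+ c :* (g :* h))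
           refl (f i) c (g i) (h i)) ⟩
    sum (λ i → f i * h i + c * (g i * h i))  ≈⟨ sum-+ {n} _ _ ⟩
    f ∙ h + sum (λ i → c * (g i * h i))      ≈⟨ +-congˡ (sum-* {n} c _) ⟩
    f ∙ h + c * g ∙ h                        ∎

  Σ⟨⟩-∙ : ∀ {m n} (c : Vector ℝ m) (b : Vector (Vector ℝ n) m) g →
          Σ⟨ c , b ⟩ ∙ g ≈ sum (λ k → c k * b k ∙ g)
  Σ⟨⟩-∙ {m} {n} c b g = begin
    sum (λ i → sum (λ k → c k * b k i) * g i)
      ≈⟨ sum-cong (λ i → trans (*-comm _ _) (sym (sum-* {m} (g i) _))) ⟩
    sum (λ i → sum (λ k → g i * (c k * b k i)))   ≈⟨ sum-swap {n} {m} _ ⟩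
    sum (λ k → sum (λ i → g i * (c k * b k i)))
      ≈⟨ sum-cong (λ k → sum-cong λ i → solve 3 (λ g c b → g :* (c :* b) := c :* (b :* g))
           refl (g i) (c k) (b k i)) ⟩
    sum (λ k → sum (λ i → c k * (b k i * g i)))   ≈⟨ sum-cong (λ k → sum-* {n} (c k) _) ⟩
    sum (λ k → c k * b k ∙ g)                     ∎

  0≤∙ : ∀ {n} (f : Vector ℝ n) → 0# ≤ f ∙ f
  0≤∙ f = 0≤sum (λ i → 0≤x*x (f i))

  ∙≈0⇒≈0 : ∀ {n} {f : Vector ℝ n} → f ∙ f ≈ 0# → ∀ i → f i ≈ 0#
  ∙≈0⇒≈0 {f = f} eq i = x*x≈0⇒x≈0 (sum≈0⇒≈0 (λ j → 0≤x*x (f j)) eq i)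

  Independent : ∀ {m n} → Vector (Vector ℝ n) m → Set
  Independent b = ∀ c → (∀ i → Σ⟨ c , b ⟩ i ≈ 0#) → ∀ k → c k ≈ 0#

  record Orthogonal {m n} (v : Vector (Vector ℝ n) m) : Set where
    field
      nonzero    : ∀ k → ¬ (v k ∙ v k ≈ 0#)
      orthogonal : ∀ k l → k ≢ l → v k ∙ v l ≈ 0#

  -- The subspace is an arbitrary predicate so that the recursion can pass to the vectors of `E`
  -- orthogonal to the first basis vector. The result is not normalised, which avoids square roots.
  gram-schmidt : ∀ {n m} (E : Vector ℝ n → Set) →
    (∀ c f g → E f → E g → E (λ i → f i + c * g i)) →
    (b : Vector (Vector ℝ n) m) → (∀ k → E (b k)) → Independent b →
    ∃[ v ] (∀ k → E (v k)) × Orthogonal {m} v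
  gram-schmidt {m = zero} E closed b b∈E ind =
    b , b∈E , record { nonzero = λ () ; orthogonal = λ () }
  gram-schmidt {n} {suc m} E closed b b∈E ind = b₀ ∷ᵥ v , v∈E , record
    { nonzero = nz ; orthogonal = og }
    where
    b₀ : Vector ℝ n
    b₀ = b zero

    N : ℝ
    N = b₀ ∙ b₀

    N≉0 : ¬ (N ≈ 0#)
    N≉0 N≈0 = 0≉1 (sym (ind (1# ∷ᵥ λ _ → 0#) zero-combination zero))
      where
      zero-combination : ∀ i → Σ⟨ 1# ∷ᵥ (λ _ → 0#) , b ⟩ i ≈ 0#
      zero-combination i = trans
        (+-cong (trans (*-identityˡ _) (∙≈0⇒≈0 N≈0 i)) (sum-zero {m} λ k → zeroˡ _))
        (+-identityˡ 0#)

    γ : Vector ℝ m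
    γ k = - (b (suc k) ∙ b₀ / N)

    b′ : Vector (Vector ℝ n) m
    b′ k i = b (suc k) i + γ k * b₀ i

    E′ : Vector ℝ n → Set
    E′ f = E f × f ∙ b₀ ≈ 0#

    b′∈E′ : ∀ k → E′ (b′ k)
    b′∈E′ k = closed (γ k) _ _ (b∈E (suc k)) (b∈E zero) , (begin
      b′ k ∙ b₀                      ≈⟨ ∙-linearˡ (γ k) (b (suc k)) b₀ b₀ ⟩
      b (suc k) ∙ b₀ + γ k * N
        ≈⟨ solve 3 (λ a t N → a :+ :- t :* N := a :- N :* t)
             refl (b (suc k) ∙ b₀) (b (suc k) ∙ b₀ / N) N ⟩
      b (suc k) ∙ b₀ - N * (b (suc k) ∙ b₀ / N)  ≈⟨ +-congˡ (-‿cong (*-/-cancel _ N≉0)) ⟩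
      b (suc k) ∙ b₀ - b (suc k) ∙ b₀            ≈⟨ -‿inverseʳ _ ⟩
      0#                                         ∎)

    closed′ : ∀ c f g → E′ f → E′ g → E′ (λ i → f i + c * g i)
    closed′ c f g (f∈E , f⊥) (g∈E , g⊥) = closed c f g f∈E g∈E , (begin
      (λ i → f i + c * g i) ∙ b₀   ≈⟨ ∙-linearˡ c f g b₀ ⟩
      f ∙ b₀ + c * g ∙ b₀          ≈⟨ +-cong f⊥ (*-congˡ g⊥) ⟩
      0# + c * 0#                  ≈⟨ trans (+-identityˡ _) (zeroʳ c) ⟩
      0#                           ∎)

    ind′ : Independent b′
    -- A relation among the `b′ k` is one among the `b k`: the multiples of `b₀` that were
    -- subtracted collect into the single coefficient `sum (λ k → c k * γ k)`.
    ind′ c eq k = ind (sum (λ k → c k * γ k) ∷ᵥ c)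
      (λ i → trans (sym (rewrite-combination i)) (eq i)) (suc k)
      where
      rewrite-combination : ∀ i → Σ⟨ c , b′ ⟩ i ≈ sum (λ k → c k * γ k) * b₀ i +
        sum (λ k → c k * b (suc k) i)
      rewrite-combination i = begin
        sum (λ k → c k * (b (suc k) i + γ k * b₀ i))
          ≈⟨ sum-cong (λ k → solve 4 (λ c b g x → c :* (b :+ g :* x) := x :* (c :* g) :+ c :* b)
               refl (c k) (b (suc k) i) (γ k) (b₀ i)) ⟩
        sum (λ k → b₀ i * (c k * γ k) + c k * b (suc k) i)             ≈⟨ sum-+ {m} _ _ ⟩
        sum (λ k → b₀ i * (c k * γ k)) + sum (λ k → c k * b (suc k) i)
          ≈⟨ +-congʳ (trans (sum-* {m} (b₀ i) _) (*-comm _ _)) ⟩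
        sum (λ k → c k * γ k) * b₀ i + sum (λ k → c k * b (suc k) i)   ∎

    rest : ∃[ v ] (∀ k → E′ (v k)) × Orthogonal {m} v
    rest = gram-schmidt E′ closed′ b′ b′∈E′ ind′

    v : Vector (Vector ℝ n) m
    v = proj₁ rest

    v∈E′ : ∀ k → E′ (v k)
    v∈E′ = proj₁ (proj₂ rest)

    open Orthogonal (proj₂ (proj₂ rest))

    v∈E : ∀ k → E ((b₀ ∷ᵥ v) k)
    v∈E zero    = b∈E zero
    v∈E (suc k) = proj₁ (v∈E′ k)

    nz : ∀ k → ¬ ((b₀ ∷ᵥ v) k ∙ (b₀ ∷ᵥ v) k ≈ 0#)
    nz zero    = N≉0
    nz (suc k) = nonzero k

    og : ∀ k l → k ≢ l → (b₀ ∷ᵥ v) k ∙ (b₀ ∷ᵥ v) l ≈ 0#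
    og zero    zero    k≢l = contradiction ≡.refl k≢l
    og zero    (suc l) _   = trans (∙-comm b₀ (v l)) (proj₂ (v∈E′ l))
    og (suc k) zero    _   = proj₂ (v∈E′ k)
    og (suc k) (suc l) k≢l = orthogonal k l (λ { ≡.refl → k≢l ≡.refl })

  δ : ∀ {n} → Fin n → Fin n → ℝ
  δ i j with i Fin.≟ j
  ... | yes _ = 1#
  ... | no _  = 0#

  δ-diagonal : ∀ {n} (i : Fin n) → δ i i ≈ 1#
  δ-diagonal i with i Fin.≟ i
  ... | yes _  = refl
  ... | no i≢i = contradiction ≡.refl i≢i

  δ-off-diagonal : ∀ {n} (i j : Fin n) → j ≢ i → δ i j ≈ 0#
  δ-off-diagonal i j j≢i with i Fin.≟ j
  ... | yes ≡.refl = contradiction ≡.refl j≢i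
  ... | no _       = refl

  sum-δ : ∀ {n} i (f : Vector ℝ n) → δ i ∙ f ≈ f i
  sum-δ i f = trans
    (sum-single _ i λ j j≢i → trans (*-congʳ (δ-off-diagonal i j j≢i)) (zeroˡ _))
    (trans (*-congʳ (δ-diagonal i)) (*-identityˡ _))

  -- The projection P onto the span of the vₖ has trace n, so that the sum over i
  -- of |δᵢ - P δᵢ|² = 1 - Pᵢᵢ vanishes, hence P is the identity.
  module Expansion {n} {v : Vector (Vector ℝ n) n} (v-orthogonal : Orthogonal v) where
    open Orthogonal v-orthogonal

    N⁻¹ : Fin n → ℝ
    N⁻¹ k = (v k ∙ v k) ⁻¹

    P : Fin n → Vector ℝ n
    P i = Σ⟨ (λ k → v k i * N⁻¹ k) , v ⟩

    -- `P i` is the image of the i-th standard basis vector, so this is |Pδᵢ|² = ⟨Pδᵢ, δᵢ⟩. It holds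
    -- because pairing `P i` with `v k` returns the coordinate `v k i`, by orthogonality.
    P-idempotent : ∀ i → P i ∙ P i ≈ P i i
    P-idempotent i = begin
      P i ∙ P i                               ≈⟨ Σ⟨⟩-∙ c v (P i) ⟩
      sum (λ k → c k * v k ∙ P i)             ≈⟨ sum-cong (λ k → *-congˡ (v∙P k)) ⟩
      sum (λ k → c k * v k i)                 ∎
      where
      c : Vector ℝ n
      c k = v k i * N⁻¹ k

      v∙P : ∀ k → v k ∙ P i ≈ v k i
      v∙P k = begin
        v k ∙ P i                             ≈⟨ ∙-comm (v k) (P i) ⟩
        P i ∙ v k                             ≈⟨ Σ⟨⟩-∙ c v (v k) ⟩
        sum (λ l → c l * v l ∙ v k)
          ≈⟨ sum-single _ k (λ l l≢k → trans (*-congˡ (orthogonal l k l≢k)) (zeroʳ _)) ⟩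
        v k i * N⁻¹ k * v k ∙ v k             ≈⟨ *-assoc _ _ _ ⟩
        v k i * (N⁻¹ k * v k ∙ v k)           ≈⟨ *-congˡ (⁻¹-inverseˡ _ (nonzero k)) ⟩
        v k i * 1#                            ≈⟨ *-identityʳ _ ⟩
        v k i                                 ∎

    trace-P : sum (λ i → P i i) ≈ ι n * 1#
    trace-P = begin
      sum (λ i → sum (λ k → v k i * N⁻¹ k * v k i))  ≈⟨ sum-swap {n} {n} _ ⟩
      sum (λ k → sum (λ i → v k i * N⁻¹ k * v k i))
        ≈⟨ sum-cong (λ k → sum-cong λ i → solve 2 (λ x y → x :* y :* x := y :* (x :* x))
             refl (v k i) (N⁻¹ k)) ⟩
      sum (λ k → sum (λ i → N⁻¹ k * (v k i * v k i)))
        ≈⟨ sum-cong (λ k → trans (sum-* {n} (N⁻¹ k) _) (⁻¹-inverseˡ _ (nonzero k))) ⟩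
      sum {n} (λ k → 1#)                             ≈⟨ sum-const n 1# ⟩
      ι n * 1#                                       ∎

    residual : Fin n → Vector ℝ n
    residual i j = δ i j - P i j

    |residual|² : ∀ i → residual i ∙ residual i ≈ 1# - P i i
    |residual|² i = begin
      residual i ∙ residual i
        ≈⟨ sum-cong (λ j → solve 2 (λ d p → (d :- p) :* (d :- p) := (d :* (d :- (p :+ p))) :+ p :* p)
             refl (δ i j) (P i j)) ⟩
      sum (λ j → δ i j * (δ i j - (P i j + P i j)) + P i j * P i j)     ≈⟨ sum-+ {n} _ _ ⟩
      δ i ∙ (λ j → δ i j - (P i j + P i j)) + P i ∙ P i
        ≈⟨ +-cong (sum-δ i _) (P-idempotent i) ⟩
      (δ i i - (P i i + P i i)) + P i i
        ≈⟨ solve 2 (λ d p → (d :- (p :+ p)) :+ p := d :- p) refl (δ i i) (P i i) ⟩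
      δ i i - P i i                                                     ≈⟨ +-congʳ (δ-diagonal i) ⟩
      1# - P i i                                                        ∎

    residual≈0 : ∀ i j → residual i j ≈ 0#
    residual≈0 i = ∙≈0⇒≈0 (sum≈0⇒≈0 (λ i → 0≤∙ (residual i)) total≈0 i)
      where
      total≈0 : sum (λ i → residual i ∙ residual i) ≈ 0#
      total≈0 = begin
        sum (λ i → residual i ∙ residual i)        ≈⟨ sum-cong |residual|² ⟩
        sum (λ i → 1# - P i i)                     ≈⟨ sum-minus {n} _ _ ⟩
        sum {n} (λ i → 1#) - sum (λ i → P i i)     ≈⟨ +-cong (sum-const n 1#) (-‿cong trace-P) ⟩
        ι n * 1# - ι n * 1#                        ≈⟨ -‿inverseʳ _ ⟩
        0#                                         ∎

    coefficient : Vector ℝ n → Vector ℝ n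
    coefficient f k = f ∙ v k * N⁻¹ k

    expansion : ∀ f j → f j ≈ Σ⟨ coefficient f , v ⟩ j
    expansion f j = begin
      f j                                                  ≈⟨ sum-δ j f ⟨
      sum (λ i → δ j i * f i)
        ≈⟨ sum-cong (λ i → *-congʳ (x-x≈0⇒x≈y (residual≈0 j i))) ⟩
      P j ∙ f                                              ≈⟨ Σ⟨⟩-∙ (λ k → v k j * N⁻¹ k) v f ⟩
      sum (λ k → v k j * N⁻¹ k * v k ∙ f)
        ≈⟨ sum-cong (λ k → trans (*-congˡ (∙-comm (v k) f))
           (solve 3 (λ a b c → a :* b :* c := c :* b :* a) refl (v k j) (N⁻¹ k) (f ∙ v k))) ⟩
      sum (λ k → f ∙ v k * N⁻¹ k * v k j)                  ∎

-- Weighted Laplacians and their eigenfunctions.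

module Laplacian (em : ExcludedMiddle 0ℓ) (R : CompleteOrderedField) where
  open CompleteOrderedField R hiding (zero)
  open OrderedField R
  open LinearAlgebra em R
  open IntegerCoefficients commutativeRing
    using (solve; _:=_; _:+_; _:*_; _:-_; :-_; con)
  open import Relation.Binary.Reasoning.Setoid setoid

  module WeightedLaplacian {n : ℕ} (W : Fin n → Fin n → ℝ)
    (W-sym : ∀ i j → W i j ≈ W j i) (0≤W : ∀ i j → 0# ≤ W i j) where

    L : Vector ℝ n → Vector ℝ n
    L f i = sum (λ j → if does (i Fin.≟ j) then 0# else W i j * (f j - f i))

    Eigen : ℝ → Vector ℝ n → Set
    Eigen μ f = ∀ i → L f i + μ * f i ≈ 0#

    -- Ordered pairs are summed, so every edge counts twice and this is twice the usual Dirichlet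
    -- form. This is the origin of the factor `ι 2` in `2f∙Lg≈-B` and `Eigen-q`.
    B : Vector ℝ n → Vector ℝ n → ℝ
    B f g = sum (λ i → sum (λ j → W i j * ((f i - f j) * (g i - g j))))

    q : Vector ℝ n → ℝ
    q f = B f f

    -- The excluded diagonal term vanishes anyway, since it contains `f i - f i`. This matters
    -- because the diagonal weights `w″ i i` may be nonzero.
    L≈ : ∀ f i → L f i ≈ sum (λ j → W i j * (f j - f i))
    L≈ f i = sum-cong {n} term
      where
      term : ∀ j → (if does (i Fin.≟ j) then 0# else W i j * (f j - f i)) ≈ W i j * (f j - f i)
      term j with i Fin.≟ j
      ... | yes ≡.refl = sym (trans (*-congˡ (-‿inverseʳ _)) (zeroʳ _))
      ... | no _       = refl

    -- Summation by parts: in one of the two copies of `f ∙ L g` the indices are exchanged, and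
    -- symmetry of the weights merges each pair of terms into a product of differences.
    2f∙Lg≈-B : ∀ f g → ι 2 * f ∙ L g ≈ - B f g
    2f∙Lg≈-B f g = begin
      ι 2 * f ∙ L g
        ≈⟨ solve 1 (λ x → con (+ 2) :* x := x :+ x) refl (f ∙ L g) ⟩
      f ∙ L g + f ∙ L g                        ≈⟨ +-cong expand (trans expand (sum-swap {n} {n} _)) ⟩
      sum (λ i → sum (λ j → f i * (W i j * (g j - g i)))) +
        sum (λ i → sum (λ j → f j * (W j i * (g i - g j))))
        ≈⟨ sum-+ {n} _ _ ⟨
      sum (λ i → sum (λ j → f i * (W i j * (g j - g i))) + sum (λ j → f j * (W j i * (g i - g j))))
        ≈⟨ sum-cong {n} (λ i → trans (sym (sum-+ {n} _ _))
             (trans (sum-cong {n} (term i)) (sum-neg {n} _))) ⟩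
      sum (λ i → - sum (λ j → W i j * ((f i - f j) * (g i - g j))))   ≈⟨ sum-neg {n} _ ⟩
      - B f g                                                         ∎
      where
      expand : f ∙ L g ≈ sum (λ i → sum (λ j → f i * (W i j * (g j - g i))))
      expand = sum-cong {n} (λ i → trans (*-congˡ (L≈ g i)) (sym (sum-* {n} (f i) _)))

      term : ∀ i j → f i * (W i j * (g j - g i)) + f j * (W j i * (g i - g j)) ≈
                     - (W i j * ((f i - f j) * (g i - g j)))
      term i j = trans (+-congˡ (*-congˡ (*-congʳ (W-sym j i))))
        (solve 5 (λ fi fj w gi gj → fi :* (w :* (gj :- gi)) :+ fj :* (w :* (gi :- gj)) :=
                                    :- (w :* ((fi :- fj) :* (gi :- gj))))
               refl (f i) (f j) (W i j) (g i) (g j))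

    B-comm : ∀ f g → B f g ≈ B g f
    B-comm f g = sum-cong {n} (λ i → sum-cong {n} (λ j → *-congˡ (*-comm _ _)))

    L-self-adjoint : ∀ f g → f ∙ L g ≈ g ∙ L f
    L-self-adjoint f g = *-cancelˡ-≈ (ι[1+n]≉0 1)
      (trans (2f∙Lg≈-B f g) (trans (-‿cong (B-comm f g)) (sym (2f∙Lg≈-B g f))))

    0≤q : ∀ f → 0# ≤ q f
    0≤q f = 0≤sum {n} (λ i → 0≤sum {n} (λ j → *-nonNeg (0≤W i j) (0≤x*x _)))

    Eigen-∙ : ∀ {μ f} → Eigen μ f → ∀ g → g ∙ L f ≈ - (μ * g ∙ f)
    Eigen-∙ {μ} {f} f∈E g = begin
      g ∙ L f
        ≈⟨ sum-cong {n} (λ i → solve 4 (λ g l m f → g :* l := g :* (l :+ m :* f) :- m :* (g :* f))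
             refl (g i) (L f i) μ (f i)) ⟩
      sum (λ i → g i * (L f i + μ * f i) - μ * (g i * f i))
        ≈⟨ sum-cong {n} (λ i → trans (+-congʳ (trans (*-congˡ (f∈E i)) (zeroʳ _))) (+-identityˡ _)) ⟩
      sum (λ i → - (μ * (g i * f i)))   ≈⟨ sum-neg {n} _ ⟩
      - sum (λ i → μ * (g i * f i))     ≈⟨ -‿cong (sum-* {n} μ _) ⟩
      - (μ * g ∙ f)                     ∎

    Eigen-q : ∀ {μ f} → Eigen μ f → q f ≈ ι 2 * (μ * f ∙ f)
    Eigen-q {μ} {f} f∈E = begin
      q f                       ≈⟨ solve 1 (λ x → x := :- (:- x)) refl (q f) ⟩
      - - q f                   ≈⟨ -‿cong (2f∙Lg≈-B f f) ⟨
      - (ι 2 * f ∙ L f)         ≈⟨ -‿cong (*-congˡ (Eigen-∙ f∈E f)) ⟩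
      - (ι 2 * - (μ * f ∙ f))   ≈⟨ solve 2 (λ c x → :- (c :* :- x) := c :* x) refl (ι 2) (μ * f ∙ f) ⟩
      ι 2 * (μ * f ∙ f)         ∎

    Eigen-orthogonal : ∀ {μ ν f g} → Eigen μ f → Eigen ν g → ¬ (μ ≈ ν) → f ∙ g ≈ 0#
    Eigen-orthogonal {μ} {ν} {f} {g} f∈E g∈E μ≉ν = *-cancelˡ-≈0 (μ≉ν ∘ x-x≈0⇒x≈y) (begin
      (μ - ν) * f ∙ g
        ≈⟨ solve 3 (λ m n x → (m :- n) :* x := :- (n :* x) :- :- (m :* x)) refl μ ν (f ∙ g) ⟩
      - (ν * f ∙ g) - - (μ * f ∙ g)
        ≈⟨ +-cong (sym (Eigen-∙ g∈E f))
           (-‿cong (trans (-‿cong (*-congˡ (∙-comm f g))) (sym (Eigen-∙ f∈E g)))) ⟩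
      f ∙ L g - g ∙ L f                ≈⟨ +-congʳ (L-self-adjoint f g) ⟩
      g ∙ L f - g ∙ L f                ≈⟨ -‿inverseʳ _ ⟩
      0#                               ∎)

    Eigen-linear : ∀ {μ} c f g → Eigen μ f → Eigen μ g → Eigen μ (λ i → f i + c * g i)
    Eigen-linear {μ} c f g f∈E g∈E i = begin
      L (λ i → f i + c * g i) i + μ * (f i + c * g i)
        ≈⟨ +-congʳ (L≈ (λ i → f i + c * g i) i) ⟩
      sum (λ j → W i j * ((f j + c * g j) - (f i + c * g i))) + μ * (f i + c * g i)
        ≈⟨ +-congʳ (sum-cong {n} (λ j → solve 6
             (λ w c fi fj gi gj → w :* ((fj :+ c :* gj) :- (fi :+ c :* gi)) :=
             w :* (fj :- fi) :+ c :* (w :* (gj :- gi))) refl (W i j) c (f i) (f j) (g i) (g j))) ⟩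
      sum (λ j → W i j * (f j - f i) + c * (W i j * (g j - g i))) + μ * (f i + c * g i)
        ≈⟨ +-congʳ (trans (sum-+ {n} _ _)
             (+-cong (sym (L≈ f i)) (trans (sum-* {n} c _) (*-congˡ (sym (L≈ g i)))))) ⟩
      (L f i + c * L g i) + μ * (f i + c * g i)
        ≈⟨ solve 6 (λ lf c lg m f g → (lf :+ c :* lg) :+ m :* (f :+ c :* g) :=
             (lf :+ m :* f) :+ c :* (lg :+ m :* g)) refl (L f i) c (L g i) μ (f i) (g i) ⟩
      (L f i + μ * f i) + c * (L g i + μ * g i)
        ≈⟨ +-cong (f∈E i) (trans (*-congˡ (g∈E i)) (zeroʳ c)) ⟩
      0# + 0#   ≈⟨ +-identityˡ 0# ⟩
      0#        ∎

    Eigen-resp : ∀ {μ ν f} → μ ≈ ν → Eigen μ f → Eigen ν f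
    Eigen-resp eq f∈E i = trans (+-congˡ (*-congʳ (sym eq))) (f∈E i)

    𝟙 : Vector ℝ n
    𝟙 _ = 1#

    𝟙-Eigen : Eigen 0# 𝟙
    𝟙-Eigen i = trans (+-cong
      (trans (L≈ 𝟙 i) (sum-zero {n} (λ j → trans (*-congˡ (-‿inverseʳ 1#)) (zeroʳ _))))
      (zeroˡ 1#)) (+-identityˡ 0#)

    𝟙∙ : ∀ f → 𝟙 ∙ f ≈ sum f
    𝟙∙ f = sum-cong {n} (λ i → *-identityˡ (f i))

    -- Since q(a) = -2⟨a, La⟩, the value is (α + 4λ)|a|² on a λ-eigenfunction of zero sum and n(α +
    -- βn) on `𝟙`. The curvature-dimension inequality reduces to its nonnegativity.
    Form : ℝ → ℝ → Vector ℝ n → ℝ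
    Form α β a = (α * a ∙ a + β * (sum a * sum a)) + ι 2 * q a

    Form-cong : ∀ {α β a b} → (∀ i → a i ≈ b i) → Form α β a ≈ Form α β b
    Form-cong {a = a} {b} eq = +-cong
      (+-cong (*-congˡ (∙-cong eq eq)) (*-congˡ (*-cong (sum-cong eq) (sum-cong eq))))
      (*-congˡ (sum-cong {n} (λ i → sum-cong {n} (λ j → *-congˡ (*-cong (diff i j) (diff i j))))))
      where
      diff : ∀ i j → a i - a j ≈ b i - b j
      diff i j = +-cong (eq i) (-‿cong (eq j))

    -- The spectral gap on functions of zero sum and the sign of the form.

    module SpectralGap
      (λs : Vector ℝ n) (v : Vector (Vector ℝ n) n) (v-orthogonal : Orthogonal v)
      (v-Eigen : ∀ k → Eigen (λs k) (v k)) (k₀ k₁ : Fin n) (k₀≢k₁ : k₀ ≢ k₁)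
      (λs-least : ∀ k → λs k₀ ≤ λs k) (λs-second : ∀ k → k ≡ k₀ ⊎ λs k₁ ≤ λs k) where

      open Orthogonal v-orthogonal
      open Expansion v-orthogonal

      λ₁ : ℝ
      λ₁ = λs k₁

      0<v∙v : ∀ k → 0# < v k ∙ v k
      0<v∙v k = ≉0⇒0< (0≤∙ (v k)) (nonzero k)

      0≤λs : ∀ k → 0# ≤ λs k
      0≤λs k = *-cancelˡ-0≤ (0<v∙v k) (*-cancelˡ-0≤ (0<ι[1+n] 1)
        (≤-respʳ (trans (Eigen-q (v-Eigen k)) (*-congˡ (*-comm _ _))) (0≤q (v k))))

      sum-v≈0 : ∀ k → ¬ (λs k ≈ 0#) → sum (v k) ≈ 0#
      sum-v≈0 k λ≉0 = trans (sym (𝟙∙ (v k)))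
        (Eigen-orthogonal 𝟙-Eigen (v-Eigen k) (λ≉0 ∘ sym))

      𝟙-coefficient≈0 : ∀ k → ¬ (λs k ≈ 0#) → coefficient 𝟙 k ≈ 0#
      𝟙-coefficient≈0 k λ≉0 = trans (*-congʳ (trans (𝟙∙ (v k)) (sum-v≈0 k λ≉0))) (zeroˡ _)

      -- Eigenfunctions of nonzero eigenvalues are orthogonal to `𝟙`. If no listed eigenvalue were
      -- zero, the expansion of `𝟙` would have only zero coefficients.
      λ₀≈0 : λs k₀ ≈ 0#
      λ₀≈0 with em {∃[ k ] λs k ≈ 0#}
      ... | yes (k , eq) = ≤-antisym (≤-respʳ eq (λs-least k)) (0≤λs k₀)
      ... | no none      = contradiction (sym 1≈0) 0≉1
        where
        1≈0 : 1# ≈ 0#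
        1≈0 = trans (expansion 𝟙 k₀) (sum-zero {n} (λ k →
          trans (*-congʳ (𝟙-coefficient≈0 k (λ eq → none (k , eq)))) (zeroˡ _)))

      -- If λ₁ ≠ 0 then v k₀ is proportional to 𝟙.
      ∙v₀≈0 : ∀ a → sum a ≈ 0# → ¬ (λ₁ ≈ 0#) → a ∙ v k₀ ≈ 0#
      ∙v₀≈0 a Σa≈0 λ₁≉0 = *-cancelˡ-≈0 c₀≉0 (begin
        c₀ * a ∙ v k₀          ≈⟨ *-congˡ (∙-comm a (v k₀)) ⟩
        c₀ * v k₀ ∙ a          ≈⟨ sum-* {n} c₀ _ ⟨
        sum (λ i → c₀ * (v k₀ i * a i))
          ≈⟨ sum-cong {n} (λ i → trans (sym (*-assoc _ _ _)) (*-congʳ (sym (𝟙≈c₀v₀ i)))) ⟩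
        𝟙 ∙ a                  ≈⟨ trans (𝟙∙ a) Σa≈0 ⟩
        0#                     ∎)
        where
        c₀ : ℝ
        c₀ = coefficient 𝟙 k₀

        λs≉0 : ∀ k → k ≢ k₀ → ¬ (λs k ≈ 0#)
        λs≉0 k k≢k₀ eq with λs-second k
        ... | inj₁ k≡k₀  = k≢k₀ k≡k₀
        ... | inj₂ λ₁≤λk = λ₁≉0 (≤-antisym (≤-respʳ eq λ₁≤λk) (0≤λs k₁))

        𝟙≈c₀v₀ : ∀ i → 1# ≈ c₀ * v k₀ i
        𝟙≈c₀v₀ i = trans (expansion 𝟙 i) (sum-single {n} _ k₀ (λ k k≢k₀ →
          trans (*-congʳ (𝟙-coefficient≈0 k (λs≉0 k k≢k₀))) (zeroˡ _)))

        c₀≉0 : ¬ (c₀ ≈ 0#)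
        c₀≉0 eq = 0≉1 (sym (trans (𝟙≈c₀v₀ k₀) (trans (*-congʳ eq) (zeroˡ _))))

      -- This is ⟨a, vₖ⟩²/|vₖ|², the squared length of the component of `a` along `v k`.
      energy : Vector ℝ n → Vector ℝ n
      energy a k = coefficient a k * a ∙ v k

      0≤energy : ∀ a k → 0# ≤ energy a k
      0≤energy a k = ≤-respʳ (solve 2 (λ x y → (x :* x) :* y := x :* y :* x) refl (a ∙ v k) (N⁻¹ k))
        (*-nonNeg (0≤x*x (a ∙ v k)) (0≤⁻¹ (0<v∙v k)))

      parseval : ∀ a → a ∙ a ≈ sum (energy a)
      parseval a = begin
        a ∙ a                                ≈⟨ ∙-cong (expansion a) (λ _ → refl) ⟩
        Σ⟨ coefficient a , v ⟩ ∙ a           ≈⟨ Σ⟨⟩-∙ (coefficient a) v a ⟩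
        sum (λ k → coefficient a k * v k ∙ a) ≈⟨ sum-cong {n} (λ k → *-congˡ (∙-comm (v k) a)) ⟩
        sum (energy a)                       ∎

      q-parseval : ∀ a → q a ≈ ι 2 * sum (λ k → λs k * energy a k)
      q-parseval a = begin
        q a                       ≈⟨ solve 1 (λ x → x := :- (:- x)) refl (q a) ⟩
        - - q a                   ≈⟨ -‿cong (2f∙Lg≈-B a a) ⟨
        - (ι 2 * a ∙ L a)         ≈⟨ solve 2 (λ c x → :- (c :* x) := c :* :- x) refl (ι 2) (a ∙ L a) ⟩
        ι 2 * - (a ∙ L a)         ≈⟨ *-congˡ (-‿cong (∙-cong (expansion a) (λ _ → refl))) ⟩
        ι 2 * - (Σ⟨ coefficient a , v ⟩ ∙ L a)   ≈⟨ *-congˡ (-‿cong (Σ⟨⟩-∙ (coefficient a) v (L a))) ⟩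
        ι 2 * - sum (λ k → coefficient a k * v k ∙ L a)   ≈⟨ *-congˡ (sum-neg {n} _) ⟨
        ι 2 * sum (λ k → - (coefficient a k * v k ∙ L a)) ≈⟨ *-congˡ (sum-cong {n} term) ⟩
        ι 2 * sum (λ k → λs k * energy a k)               ∎
        where
        term : ∀ k → - (coefficient a k * v k ∙ L a) ≈ λs k * energy a k
        term k = begin
          - (coefficient a k * v k ∙ L a)
            ≈⟨ -‿cong (*-congˡ (trans (L-self-adjoint (v k) a) (Eigen-∙ (v-Eigen k) a))) ⟩
          - (coefficient a k * - (λs k * a ∙ v k))
            ≈⟨ solve 3 (λ c l x → :- (c :* :- (l :* x)) := l :* (c :* x))
                 refl (coefficient a k) (λs k) (a ∙ v k) ⟩
          λs k * energy a k     ∎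

      -- Expanded in the eigenbasis, only the term of `k₀` could be negative. It vanishes: if λ₁ =
      -- 0, its coefficient λ₀ - λ₁ is zero; otherwise `v k₀` is a multiple of `𝟙` and hence
      -- orthogonal to `a`.
      gap : ∀ a → sum a ≈ 0# → 0# ≤ q a - ι 2 * (λ₁ * a ∙ a)
      gap a Σa≈0 = ≤-respʳ (sym rewritten) (*-nonNeg (0≤ι 2) (0≤sum {n} term))
        where
        rewritten : q a - ι 2 * (λ₁ * a ∙ a) ≈ ι 2 * sum (λ k → (λs k - λ₁) * energy a k)
        rewritten = begin
          q a - ι 2 * (λ₁ * a ∙ a)
            ≈⟨ +-cong (q-parseval a) (-‿cong
                 (*-congˡ (trans (*-congˡ (parseval a)) (sym (sum-* {n} λ₁ _))))) ⟩
          ι 2 * sum (λ k → λs k * energy a k) - ι 2 * sum (λ k → λ₁ * energy a k)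
            ≈⟨ solve 3 (λ c x y → c :* x :- c :* y := c :* (x :- y)) refl (ι 2) _ _ ⟩
          ι 2 * (sum (λ k → λs k * energy a k) - sum (λ k → λ₁ * energy a k))
            ≈⟨ *-congˡ (sum-minus {n} _ _) ⟨
          ι 2 * sum (λ k → λs k * energy a k - λ₁ * energy a k)
            ≈⟨ *-congˡ (sum-cong {n} (λ k → solve 3 (λ x y e → x :* e :- y :* e := (x :- y) :* e)
                 refl (λs k) λ₁ (energy a k))) ⟩
          ι 2 * sum (λ k → (λs k - λ₁) * energy a k)   ∎

        term : ∀ k → 0# ≤ (λs k - λ₁) * energy a k
        term k with λs-second k
        ... | inj₂ λ₁≤λk = *-nonNeg (≤⇒0≤- λ₁≤λk) (0≤energy a k)
        ... | inj₁ ≡.refl with em {λ₁ ≈ 0#}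
        ...   | yes λ₁≈0 = ≤-reflexive (sym (trans (*-congʳ
                  (trans (+-cong λ₀≈0 (-‿cong λ₁≈0)) (-‿inverseʳ 0#))) (zeroˡ _)))
        ...   | no λ₁≉0  = ≤-reflexive (sym (trans (*-congˡ
                  (trans (*-congˡ (∙v₀≈0 a Σa≈0 λ₁≉0)) (zeroʳ _))) (zeroʳ _)))

      -- `v k₁` itself serves unless its sum is nonzero. In that case it is not orthogonal to `𝟙`,
      -- so λ₁ = 0, and both `v k₀` and `v k₁` lie in the kernel; a combination of them then has
      -- zero sum.
      gap-attained : ∃[ a ] sum a ≈ 0# × 0# < a ∙ a × Eigen λ₁ a
      gap-attained with em {sum (v k₁) ≈ 0#}
      ... | yes Σv≈0 = v k₁ , Σv≈0 , 0<v∙v k₁ , v-Eigen k₁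
      ... | no Σv≉0  = a , Σa≈0 , ≉0⇒0< (0≤∙ a) a∙a≉0 , a∈E
        where
        λ₁≈0 : λ₁ ≈ 0#
        λ₁≈0 with em {λ₁ ≈ 0#}
        ... | yes λ₁≈0 = λ₁≈0
        ... | no λ₁≉0  = contradiction (sum-v≈0 k₁ λ₁≉0) Σv≉0

        s₀ s₁ c : ℝ
        s₀ = sum (v k₀)
        s₁ = sum (v k₁)
        c  = - (s₀ / s₁)

        a : Vector ℝ n
        a i = v k₀ i + c * v k₁ i

        a∈E : Eigen λ₁ a
        a∈E = Eigen-linear c (v k₀) (v k₁)
          (Eigen-resp (trans λ₀≈0 (sym λ₁≈0)) (v-Eigen k₀)) (v-Eigen k₁)

        Σa≈0 : sum a ≈ 0#
        Σa≈0 = begin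
          sum a                         ≈⟨ sum-+ {n} _ _ ⟩
          s₀ + sum (λ i → c * v k₁ i)   ≈⟨ +-congˡ (sum-* {n} c _) ⟩
          s₀ + c * s₁
            ≈⟨ solve 3 (λ x t y → x :+ :- t :* y := x :- y :* t) refl s₀ (s₀ / s₁) s₁ ⟩
          s₀ - s₁ * (s₀ / s₁)           ≈⟨ +-congˡ (-‿cong (*-/-cancel s₀ Σv≉0)) ⟩
          s₀ - s₀                       ≈⟨ -‿inverseʳ s₀ ⟩
          0#                            ∎

        -- Pairing with `v k₀` does not see the correction by `v k₁`, and so shows that the
        -- combination is not zero.
        a∙v₀≈v₀∙v₀ : a ∙ v k₀ ≈ v k₀ ∙ v k₀
        a∙v₀≈v₀∙v₀ = trans (∙-linearˡ c (v k₀) (v k₁) (v k₀)) (trans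
          (+-congˡ (trans (*-congˡ (orthogonal k₁ k₀ (k₀≢k₁ ∘ ≡.sym))) (zeroʳ c))) (+-identityʳ _))

        a∙a≉0 : ¬ (a ∙ a ≈ 0#)
        a∙a≉0 eq = nonzero k₀ (trans (sym a∙v₀≈v₀∙v₀)
          (sum-zero {n} (λ i → trans (*-congʳ (∙≈0⇒≈0 {f = a} eq i)) (zeroˡ _))))

      -- Split `a` into its mean `m` and a part `a′` of zero sum. The form becomes (α + 4λ₁)|a′|² +
      -- nm²(α + βn) plus twice the nonnegative quantity of `gap` at `a′`.
      0≤Form⁺ : ∀ {α β} → 0# ≤ α + ι 4 * λ₁ → 0# ≤ α + β * ι n → ∀ a → 0# ≤ Form α β a
      0≤Form⁺ {α} {β} h₁ h₂ a = ≤-respʳ (sym decomposed)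
        (0≤+ (0≤+ (*-nonNeg h₁ (0≤∙ a′)) (*-nonNeg (*-nonNeg (0≤ι n) (0≤x*x m)) h₂))
             (*-nonNeg (0≤ι 2) (gap a′ Σa′≈0)))
        where
        m : ℝ
        m = sum a / ι n

        a′ : Vector ℝ n
        a′ i = a i - m

        Σa≈nm : sum a ≈ ι n * m
        Σa≈nm = sym (*-/-cancel (sum a) (proj₂ (0<ι k₀) ∘ sym))

        Σa′≈0 : sum a′ ≈ 0#
        Σa′≈0 = trans (sum-minus {n} a (λ _ → m))
          (trans (+-cong Σa≈nm (-‿cong (sum-const n m))) (-‿inverseʳ _))

        a∙a≈ : a ∙ a ≈ a′ ∙ a′ + ι n * (m * m)
        a∙a≈ = begin
          a ∙ a
            ≈⟨ sum-cong {n} (λ i → solve 2 (λ a m → a :* a :=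
                 ((a :- m) :* (a :- m) :+ (m :+ m) :* (a :- m)) :+ m :* m) refl (a i) m) ⟩
          sum (λ i → (a′ i * a′ i + (m + m) * a′ i) + m * m)
            ≈⟨ trans (sum-+ {n} _ _) (+-cong (sum-+ {n} _ _) (sum-const n (m * m))) ⟩
          (a′ ∙ a′ + sum (λ i → (m + m) * a′ i)) + ι n * (m * m)
            ≈⟨ +-congʳ (trans (+-congˡ (trans (sum-* {n} (m + m) a′) (trans (*-congˡ Σa′≈0) (zeroʳ _))))
                 (+-identityʳ _)) ⟩
          a′ ∙ a′ + ι n * (m * m)   ∎

        q≈ : q a ≈ q a′
        q≈ = sum-cong {n} (λ i → sum-cong {n} (λ j → *-congˡ (*-cong (shift i j) (shift i j))))
          where
          shift : ∀ i j → a i - a j ≈ a′ i - a′ j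
          shift i j = solve 3 (λ x y m → x :- y := (x :- m) :- (y :- m)) refl (a i) (a j) m

        decomposed : Form α β a ≈
          ((α + ι 4 * λ₁) * a′ ∙ a′ + (ι n * (m * m)) * (α + β * ι n)) +
            ι 2 * (q a′ - ι 2 * (λ₁ * a′ ∙ a′))
        decomposed = begin
          Form α β a
            ≈⟨ +-cong (+-cong (*-congˡ a∙a≈) (*-congˡ (*-cong Σa≈nm Σa≈nm))) (*-congˡ q≈) ⟩
          (α * (a′ ∙ a′ + ι n * (m * m)) + β * (ι n * m * (ι n * m))) + ι 2 * q a′
            ≈⟨ solve 7 (λ α β s n m q l →
                 (α :* (s :+ n :* (m :* m)) :+ β :* (n :* m :* (n :* m))) :+ con (+ 2) :* q :=
                 ((α :+ con (+ 4) :* l) :* s :+ (n :* (m :* m)) :* (α :+ β :* n)) :+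
                   con (+ 2) :* (q :- con (+ 2) :* (l :* s)))
                 refl α β (a′ ∙ a′) (ι n) m (q a′) λ₁ ⟩
          ((α + ι 4 * λ₁) * a′ ∙ a′ + (ι n * (m * m)) * (α + β * ι n)) +
            ι 2 * (q a′ - ι 2 * (λ₁ * a′ ∙ a′)) ∎

      -- The test functions are the one from `gap-attained`, for which the β term drops out, and
      -- `𝟙`, for which `q` does.
      0≤Form⁻ : ∀ {α β} → (∀ a → 0# ≤ Form α β a) → 0# ≤ α + ι 4 * λ₁ × 0# ≤ α + β * ι n
      0≤Form⁻ {α} {β} h = h₁ , h₂
        where
        h₁ : 0# ≤ α + ι 4 * λ₁
        h₁ with gap-attained
        ... | a , Σa≈0 , 0<a∙a , a∈E = *-cancelˡ-0≤ 0<a∙a (≤-respʳ (begin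
          Form α β a
            ≈⟨ +-cong (+-congˡ (*-congˡ (*-congʳ Σa≈0))) (*-congˡ (Eigen-q a∈E)) ⟩
          (α * a ∙ a + β * (0# * sum a)) + ι 2 * (ι 2 * (λ₁ * a ∙ a))
            ≈⟨ solve 5 (λ α β s t l →
                 (α :* s :+ β :* (con (+ 0) :* t)) :+ con (+ 2) :* (con (+ 2) :* (l :* s)) :=
                 s :* (α :+ con (+ 4) :* l)) refl α β (a ∙ a) (sum a) λ₁ ⟩
          a ∙ a * (α + ι 4 * λ₁) ∎) (h a))

        h₂ : 0# ≤ α + β * ι n
        h₂ = *-cancelˡ-0≤ (0<ι k₀) (≤-respʳ (begin
          Form α β 𝟙
            ≈⟨ +-cong (+-cong (*-congˡ 𝟙∙𝟙) (*-congˡ (*-cong Σ𝟙 Σ𝟙))) (*-congˡ q𝟙) ⟩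
          (α * ι n + β * (ι n * ι n)) + ι 2 * (ι 2 * (0# * 𝟙 ∙ 𝟙))
            ≈⟨ solve 4 (λ α β n s →
                 (α :* n :+ β :* (n :* n)) :+ con (+ 2) :* (con (+ 2) :* (con (+ 0) :* s)) :=
                 n :* (α :+ β :* n)) refl α β (ι n) (𝟙 ∙ 𝟙) ⟩
          ι n * (α + β * ι n) ∎) (h 𝟙))
          where
          Σ𝟙 : sum 𝟙 ≈ ι n
          Σ𝟙 = trans (sum-const n 1#) (*-identityʳ _)

          𝟙∙𝟙 : 𝟙 ∙ 𝟙 ≈ ι n
          𝟙∙𝟙 = trans (𝟙∙ 𝟙) Σ𝟙

          q𝟙 : q 𝟙 ≈ ι 2 * (0# * 𝟙 ∙ 𝟙)
          q𝟙 = Eigen-q 𝟙-Eigen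

-- Vertex sets as duplicate-free lists, and the ball of radius 2.

lookup-injective : ∀ {A : Set} {xs : List A} → Unique xs →
                   ∀ i j → lookup xs i ≡ lookup xs j → i ≡ j
lookup-injective (_ ∷ _)     zero    zero    _  = ≡.refl
lookup-injective (x∉xs ∷ _)  zero    (suc j) eq = contradiction eq (All.lookup x∉xs (∈-lookup j))
lookup-injective (x∉xs ∷ _)  (suc i) zero    eq = contradiction (≡.sym eq) (All.lookup x∉xs (∈-lookup i))
lookup-injective (_ ∷ xs!)   (suc i) (suc j) eq = ≡.cong suc (lookup-injective xs! i j eq)

-- Together with `sumOver-↭` this moves sums over a neighbourhood to the fixed enumerations `nbrs x`
-- and `S₂`.
unique-↭ : ∀ {A : Set} {xs ys : List A} → Unique xs → Unique ys →
           (∀ {v} → v ∈ xs → v ∈ ys) → (∀ {v} → v ∈ ys → v ∈ xs) → xs ↭ ys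
unique-↭ xs! ys! to from = ∼bag⇒↭ (unique∧set⇒bag xs! ys! (mk⇔ to from))

module VertexCurvature (em : ExcludedMiddle 0ℓ) (R : CompleteOrderedField)
  (G : LocallyFiniteGraph) (x : LocallyFiniteGraph.V G) where
  open CompleteOrderedField R hiding (zero)
  open LocallyFiniteGraph G
  open Curvature em R G
  open AtVertex x
  open OrderedField R
  open LinearAlgebra em R
  open Laplacian em R
  open IntegerCoefficients commutativeRing
    using (solve; _:=_; _:+_; _:*_; _:-_; :-_; con)
  open import Relation.Binary.Reasoning.Setoid setoid

  sumOver-↭ : ∀ {us vs} f → us ↭ vs → sumOver us f ≈ sumOver vs f
  sumOver-↭ f Perm.refl                = refl
  sumOver-↭ f (Perm.prep v us↭vs)      = +-congˡ (sumOver-↭ f us↭vs)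
  sumOver-↭ f (Perm.swap u v us↭vs)    = trans (+-congˡ (+-congˡ (sumOver-↭ f us↭vs)))
    (solve 3 (λ a b c → a :+ (b :+ c) := b :+ (a :+ c)) refl _ _ _)
  sumOver-↭ f (Perm.trans us↭vs vs↭ws) = trans (sumOver-↭ f us↭vs) (sumOver-↭ f vs↭ws)

  sumOver-++ : ∀ us {vs} f → sumOver (us ++ vs) f ≈ sumOver us f + sumOver vs f
  sumOver-++ []       f = sym (+-identityˡ _)
  sumOver-++ (u ∷ us) f = trans (+-congˡ (sumOver-++ us f)) (sym (+-assoc _ _ _))

  sumOver-filter : ∀ u vs f →
    sumOver (filter (λ v → em {u ~ v}) vs) f ≈ sumOver vs (λ v → w u v * f v)
  sumOver-filter u []       f = refl
  sumOver-filter u (v ∷ vs) f with em {u ~ v}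
  ... | yes _ = +-cong (sym (*-identityˡ _)) (sumOver-filter u vs f)
  ... | no _  = trans (sumOver-filter u vs f) (sym (trans (+-congʳ (zeroˡ _)) (+-identityˡ _)))

  ι-length : ∀ (vs : List V) → ι (length vs) ≈ sumOver vs (λ _ → 1#)
  ι-length vs = sym (trans (sum-const (length vs) 1#) (*-identityʳ _))

  w≈1 : ∀ {u v} → u ~ v → w u v ≈ 1#
  w≈1 {u} {v} u~v with em {u ~ v}
  ... | yes _  = refl
  ... | no u≁v = contradiction u~v u≁v

  w-sym : ∀ u v → w u v ≈ w v u
  w-sym u v with em {u ~ v} | em {v ~ u}
  ... | yes _   | yes _   = refl
  ... | no _    | no _    = refl
  ... | yes u~v | no v≁u  = contradiction (~-sym u~v) v≁u
  ... | no u≁v  | yes v~u = contradiction (~-sym v~u) u≁v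

  0≤w : ∀ u v → 0# ≤ w u v
  0≤w u v with em {u ~ v}
  ... | yes _ = 0≤1
  ... | no _  = ≤-reflexive refl

  ∈-nbrs⁺ : ∀ {u v} → u ~ v → v ∈ nbrs u
  ∈-nbrs⁺ = Equivalence.from ∈-nbrs

  ∈-nbrs⁻ : ∀ {u v} → v ∈ nbrs u → u ~ v
  ∈-nbrs⁻ = Equivalence.to ∈-nbrs

  x~y : ∀ i → x ~ y i
  x~y i = ∈-nbrs⁻ (∈-lookup i)

  S₁⁺ : ∀ {u} → x ~ u → S 1 x u
  S₁⁺ {u} x~u = cons x~u nil , λ { zero _ nil → ~-irrefl ≡.refl x~u ; (suc _) (s≤s ()) _ }

  S₁⁻ : ∀ {u} → S 1 x u → x ~ u
  S₁⁻ (cons x~u nil , _) = x~u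

  S₂⇒≢ : ∀ {z} → S 2 x z → x ≢ z
  S₂⇒≢ (_ , minimal) ≡.refl = minimal 0 (s≤s z≤n) nil

  S₂⇒≁ : ∀ {z} → S 2 x z → ¬ (x ~ z)
  S₂⇒≁ (_ , minimal) x~z = minimal 1 (s≤s (s≤s z≤n)) (cons x~z nil)

  S₂⇒∃ : ∀ {z} → S 2 x z → ∃[ u ] (x ~ u × u ~ z)
  S₂⇒∃ (cons x~u (cons u~z nil) , _) = _ , x~u , u~z

  S₂-intro : ∀ {u z} → x ~ u → u ~ z → x ≢ z → ¬ (x ~ z) → S 2 x z
  S₂-intro x~u u~z x≢z x≁z = cons x~u (cons u~z nil) , λ
    { zero       _ nil            → x≢z ≡.refl
    ; (suc zero) _ (cons x~z nil) → x≁z x~z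
    ; (suc (suc _)) (s≤s (s≤s ())) _
    }

  ∈-S₂⁻ : ∀ {z} → z ∈ S₂ → S 2 x z
  ∈-S₂⁻ z∈S₂ = proj₂ (∈-filter⁻ (λ z → em {S 2 x z})
    {xs = deduplicate (λ u v → em {u ≡ v}) (concatMap nbrs (nbrs x))} z∈S₂)

  ∈-S₂⁺ : ∀ {z} → S 2 x z → z ∈ S₂
  ∈-S₂⁺ {z} s with S₂⇒∃ s
  ... | u , x~u , u~z = ∈-filter⁺ (λ z → em {S 2 x z})
    (∈-deduplicate⁺ (λ u v → em {u ≡ v})
      (∈-concatMap⁺ nbrs (lose (∈-nbrs⁺ x~u) (∈-nbrs⁺ u~z)))) s

  S₂-unique : Unique S₂
  S₂-unique = Unique.filter⁺ (λ z → em {S 2 x z})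
    (UniqueDec.deduplicate-! (λ u v → em {u ≡ v}) (concatMap nbrs (nbrs x)))

  -- Every neighbour of a `y i` occurs here exactly once, so sums over `nbrs (y i)` become sums over
  -- one list, independent of `i`, with the indicator `w` as weight.
  ball : List V
  ball = x ∷ (nbrs x ++ S₂)

  ball-unique : Unique ball
  ball-unique = All.tabulate x∉ ∷ Unique.++⁺ (nbrs-uniq x) S₂-unique disjoint
    where
    x∉ : ∀ {v} → v ∈ nbrs x ++ S₂ → x ≢ v
    x∉ v∈ with ∈-++⁻ (nbrs x) v∈
    ... | inj₁ v∈S₁ = λ x≡v → ~-irrefl x≡v (∈-nbrs⁻ v∈S₁)
    ... | inj₂ v∈S₂ = S₂⇒≢ (∈-S₂⁻ v∈S₂)

    disjoint : ∀ {v} → ¬ (v ∈ nbrs x × v ∈ S₂)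
    disjoint (v∈S₁ , v∈S₂) = S₂⇒≁ (∈-S₂⁻ v∈S₂) (∈-nbrs⁻ v∈S₁)

  ∈-ball : ∀ {u v} → x ~ u → u ~ v → v ∈ ball
  ∈-ball {u} {v} x~u u~v with em {x ≡ v} | em {x ~ v}
  ... | yes ≡.refl | _       = here ≡.refl
  ... | no _       | yes x~v = there (∈-++⁺ˡ (∈-nbrs⁺ x~v))
  ... | no x≢v     | no x≁v  = there (∈-++⁺ʳ (nbrs x) (∈-S₂⁺ (S₂-intro x~u u~v x≢v x≁v)))

  sum-nbrs : ∀ i f → sumOver (nbrs (y i)) f ≈
    f x + (sum (λ j → w (y i) (y j) * f (y j)) + sumOver S₂ (λ z → w (y i) z * f z))
  sum-nbrs i f = begin
    sumOver (nbrs (y i)) f                             ≈⟨ sumOver-↭ f nbrs↭ ⟩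
    sumOver (filter (λ v → em {y i ~ v}) ball) f       ≈⟨ sumOver-filter (y i) ball f ⟩
    w (y i) x * f x + sumOver (nbrs x ++ S₂) (λ v → w (y i) v * f v)
      ≈⟨ +-cong (trans (*-congʳ (w≈1 (~-sym (x~y i)))) (*-identityˡ _))
           (sumOver-++ (nbrs x) (λ v → w (y i) v * f v)) ⟩
    f x + (sum (λ j → w (y i) (y j) * f (y j)) + sumOver S₂ (λ z → w (y i) z * f z)) ∎
    where
    nbrs↭ : nbrs (y i) ↭ filter (λ v → em {y i ~ v}) ball
    nbrs↭ = unique-↭ (nbrs-uniq (y i)) (Unique.filter⁺ (λ v → em {y i ~ v}) ball-unique)
      (λ v∈ → ∈-filter⁺ (λ v → em {y i ~ v}) (∈-ball (x~y i) (∈-nbrs⁻ v∈)) (∈-nbrs⁻ v∈))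
      (λ v∈ → ∈-nbrs⁺ (proj₂ (∈-filter⁻ (λ v → em {y i ~ v}) {xs = ball} v∈)))

  ι-d⁺ : ∀ i → ι (d⁺ (y i)) ≈ sumOver S₂ (w (y i))
  ι-d⁺ i = begin
    ι (d⁺ (y i))
      ≈⟨ ι-length (filter (λ z → em {S 2 x z}) (nbrs (y i))) ⟩
    sumOver (filter (λ z → em {S 2 x z}) (nbrs (y i))) (λ _ → 1#)
      ≈⟨ sumOver-↭ _ filter↭ ⟩
    sumOver (filter (λ z → em {y i ~ z}) S₂) (λ _ → 1#)  ≈⟨ sumOver-filter (y i) S₂ _ ⟩
    sumOver S₂ (λ z → w (y i) z * 1#)                    ≈⟨ sum-cong {length S₂} (λ _ → *-identityʳ _) ⟩
    sumOver S₂ (w (y i))                                 ∎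
    where
    filter↭ : filter (λ z → em {S 2 x z}) (nbrs (y i)) ↭ filter (λ z → em {y i ~ z}) S₂
    filter↭ = unique-↭
      (Unique.filter⁺ (λ z → em {S 2 x z}) (nbrs-uniq (y i)))
      (Unique.filter⁺ (λ z → em {y i ~ z}) S₂-unique)
      (λ z∈ → let z∈nbrs , z∈S₂ = ∈-filter⁻ (λ z → em {S 2 x z}) {xs = nbrs (y i)} z∈ in
        ∈-filter⁺ (λ z → em {y i ~ z}) (∈-S₂⁺ z∈S₂) (∈-nbrs⁻ z∈nbrs))
      (λ z∈ → let z∈S₂ , y~z = ∈-filter⁻ (λ z → em {y i ~ z}) {xs = S₂} z∈ in
        ∈-filter⁺ (λ z → em {S 2 x z}) (∈-nbrs⁺ y~z) (∈-S₂⁻ z∈S₂))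

  d⁻↭ : ∀ z → filter (λ u → em {S 1 x u}) (nbrs z) ↭ filter (λ u → em {z ~ u}) (nbrs x)
  d⁻↭ z = unique-↭
    (Unique.filter⁺ (λ u → em {S 1 x u}) (nbrs-uniq z))
    (Unique.filter⁺ (λ u → em {z ~ u}) (nbrs-uniq x))
    (λ u∈ → let u∈nbrs , u∈S₁ = ∈-filter⁻ (λ u → em {S 1 x u}) {xs = nbrs z} u∈ in
      ∈-filter⁺ (λ u → em {z ~ u}) (∈-nbrs⁺ (S₁⁻ u∈S₁)) (∈-nbrs⁻ u∈nbrs))
    (λ u∈ → let u∈nbrs , z~u = ∈-filter⁻ (λ u → em {z ~ u}) {xs = nbrs x} u∈ in
      ∈-filter⁺ (λ u → em {S 1 x u}) (∈-nbrs⁺ z~u) (S₁⁺ (∈-nbrs⁻ u∈nbrs)))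

  ι-d⁻ : ∀ z → ι (d⁻ z) ≈ sum (λ i → w (y i) z)
  ι-d⁻ z = begin
    ι (d⁻ z)
      ≈⟨ ι-length (filter (λ u → em {S 1 x u}) (nbrs z)) ⟩
    sumOver (filter (λ u → em {S 1 x u}) (nbrs z)) (λ _ → 1#)      ≈⟨ sumOver-↭ _ (d⁻↭ z) ⟩
    sumOver (filter (λ u → em {z ~ u}) (nbrs x)) (λ _ → 1#)        ≈⟨ sumOver-filter z (nbrs x) _ ⟩
    sumOver (nbrs x) (λ u → w z u * 1#)
      ≈⟨ sum-cong {d} (λ i → trans (*-identityʳ _) (w-sym z (y i))) ⟩
    sum (λ i → w (y i) z)                                          ∎

  -- The middle vertex of a walk of length 2 from `x` to `z` is counted by `d⁻ z`. This justifies
  -- the divisions in `w′` and in the means over S₁(x).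
  ι-d⁻≉0 : ∀ {z} → z ∈ S₂ → ¬ (ι (d⁻ z) ≈ 0#)
  ι-d⁻≉0 {z} z∈S₂ with S₂⇒∃ (∈-S₂⁻ z∈S₂)
  ... | u , x~u , u~z = nonempty
    (∈-filter⁺ (λ u → em {S 1 x u}) (∈-nbrs⁺ (~-sym u~z)) (S₁⁺ x~u))
    where
    nonempty : ∀ {us : List V} → u ∈ us → ¬ (ι (length us) ≈ 0#)
    nonempty {_ ∷ us} _ = ι[1+n]≉0 (length us)

  w″-sym : ∀ i j → w″ i j ≈ w″ j i
  w″-sym i j = +-cong (w-sym (y i) (y j)) (sum-cong {length S₂} (λ k →
    *-congʳ (trans (*-comm _ _) (*-cong (w-sym _ _) (w-sym _ _)))))

  0≤w″ : ∀ i j → 0# ≤ w″ i j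
  0≤w″ i j = 0≤+ (0≤w (y i) (y j)) (0≤sum {length S₂} (λ k →
    let z = lookup S₂ k in
    *-nonNeg (*-nonNeg (0≤w (y i) z) (0≤w z (y j)))
      (0≤⁻¹ (≉0⇒0< (0≤ι (d⁻ z)) (ι-d⁻≉0 (∈-lookup {xs = S₂} k))))))

  open WeightedLaplacian w″ w″-sym 0≤w″

  -- Expansion of Γ and Γ₂ at `x`.

  2Γ : ∀ f g u → ι 2 * Γ f g u ≈ sumOver (nbrs u) (λ v → (f v - f u) * (g v - g u))
  2Γ f g u = begin
    ι 2 * Γ f g u                                                  ≈⟨ *-/-cancel _ (ι[1+n]≉0 1) ⟩
    Δ (λ v → f v * g v) u - f u * Δ g u - g u * Δ f u
      ≈⟨ +-cong (+-congˡ (-‿cong (sym (sum-* {n} (f u) _)))) (-‿cong (sym (sum-* {n} (g u) _))) ⟩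
    (Δ (λ v → f v * g v) u - sumOver (nbrs u) (λ v → f u * (g v - g u))) -
      sumOver (nbrs u) (λ v → g u * (f v - f u))
      ≈⟨ +-congʳ (sum-minus {n} _ _) ⟨
    sumOver (nbrs u) (λ v → (f v * g v - f u * g u) - f u * (g v - g u)) -
      sumOver (nbrs u) (λ v → g u * (f v - f u))
      ≈⟨ sum-minus {n} _ _ ⟨
    sumOver (nbrs u) (λ v → ((f v * g v - f u * g u) - f u * (g v - g u)) - g u * (f v - f u))
      ≈⟨ sum-cong {n} (λ k → solve 4 (λ fv gv fu gu →
           ((fv :* gv :- fu :* gu) :- fu :* (gv :- gu)) :- gu :* (fv :- fu) :=
           (fv :- fu) :* (gv :- gu)) refl (f (v k)) (g (v k)) (f u) (g u)) ⟩
    sumOver (nbrs u) (λ v → (f v - f u) * (g v - g u))             ∎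
    where
    n : ℕ
    n = length (nbrs u)

    v : Fin n → V
    v = lookup (nbrs u)

  -- The square in c is completed; what remains is the weighted variance of a.
  variance : ∀ {n} (u a : Vector ℝ n) c D → ¬ (D ≈ 0#) → D ≈ sum u →
    sum (λ i → u i * ((c - ι 2 * a i) * (c - ι 2 * a i))) ≈
    ι 2 * sum (λ i → sum (λ j → u i * u j / D * ((a i - a j) * (a i - a j))))
      + D * ((c - ι 2 * (u ∙ a / D)) * (c - ι 2 * (u ∙ a / D)))
  variance {n} u a c D D≉0 D≈Σu = begin
    sum (λ i → u i * ((c - ι 2 * a i) * (c - ι 2 * a i)))
      ≈⟨ sum-cong {n} (λ i → solve 3 (λ u a c → u :* ((c :- con (+ 2) :* a) :* (c :- con (+ 2) :* a)) :=
           (c :* c) :* u :+ ((:- (con (+ 4) :* c)) :* (u :* a) :+ con (+ 4) :* (u :* (a :* a))))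
             refl (u i) (a i) c) ⟩
    sum (λ i → (c * c) * u i + (- (ι 4 * c) * (u i * a i) + ι 4 * (u i * (a i * a i))))
      ≈⟨ trans (sum-+ {n} _ _) (+-cong (sum-* {n} (c * c) u) (trans (sum-+ {n} _ _)
           (+-cong (sum-* {n} (- (ι 4 * c)) _) (sum-* {n} (ι 4) _)))) ⟩
    (c * c) * sum u + (- (ι 4 * c) * s + ι 4 * Q)
      ≈⟨ +-cong (*-congˡ (sym D≈Σu)) (+-congʳ (*-congˡ (sym Dt≈s))) ⟩
    (c * c) * D + (- (ι 4 * c) * (D * t) + ι 4 * Q)
      ≈⟨ solve 4 (λ c D t Q →
           (c :* c) :* D :+ ((:- (con (+ 4) :* c)) :* (D :* t) :+ con (+ 4) :* Q) :=
           con (+ 2) :* (con (+ 2) :* Q :- con (+ 2) :* (D :* t :* t)) :+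
             D :* ((c :- con (+ 2) :* t) :* (c :- con (+ 2) :* t))) refl c D t Q ⟩
    ι 2 * (ι 2 * Q - ι 2 * (D * t * t)) + D * ((c - ι 2 * t) * (c - ι 2 * t))
      ≈⟨ +-congʳ (*-congˡ (sym pairs)) ⟩
    ι 2 * sum (λ i → sum (λ j → u i * u j / D * ((a i - a j) * (a i - a j)))) +
      D * ((c - ι 2 * t) * (c - ι 2 * t)) ∎
    where
    s t Q : ℝ
    s = u ∙ a
    t = s / D
    Q = sum (λ i → u i * (a i * a i))

    Dt≈s : D * t ≈ s
    Dt≈s = *-/-cancel s D≉0

    row : ∀ i → sum (λ j → u i * u j / D * ((a i - a j) * (a i - a j))) ≈
                u i * (a i * a i) + (- (ι 2 * t) * (u i * a i) + (Q * D ⁻¹) * u i)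
    row i = begin
      sum (λ j → u i * u j / D * ((a i - a j) * (a i - a j)))
        ≈⟨ sum-cong {n} (λ j → solve 5 (λ ui uj r ai aj →
             ui :* uj :* r :* ((ai :- aj) :* (ai :- aj)) :=
             (ui :* (ai :* ai) :* r) :* uj :+
               ((:- (con (+ 2) :* (ui :* ai) :* r)) :* (uj :* aj) :+ (ui :* r) :* (uj :* (aj :* aj))))
             refl (u i) (u j) (D ⁻¹) (a i) (a j)) ⟩
      sum (λ j → (u i * (a i * a i) * D ⁻¹) * u j +
        (- (ι 2 * (u i * a i) * D ⁻¹) * (u j * a j) + (u i * D ⁻¹) * (u j * (a j * a j))))
        ≈⟨ trans (sum-+ {n} _ _) (+-cong (sum-* {n} _ u) (trans (sum-+ {n} _ _)
             (+-cong (sum-* {n} _ _) (sum-* {n} _ _)))) ⟩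
      (u i * (a i * a i) * D ⁻¹) * sum u + (- (ι 2 * (u i * a i) * D ⁻¹) * s + (u i * D ⁻¹) * Q)
        ≈⟨ +-congʳ (trans (*-congˡ (sym D≈Σu))
             (trans (*-assoc _ _ _) (trans (*-congˡ (⁻¹-inverseˡ D D≉0)) (*-identityʳ _)))) ⟩
      u i * (a i * a i) + (- (ι 2 * (u i * a i) * D ⁻¹) * s + (u i * D ⁻¹) * Q)
        ≈⟨ +-congˡ (solve 5 (λ u a r s Q → (:- (con (+ 2) :* (u :* a) :* r)) :* s :+ (u :* r) :* Q :=
             (:- (con (+ 2) :* (s :* r))) :* (u :* a) :+ (Q :* r) :* u) refl (u i) (a i) (D ⁻¹) s Q) ⟩
      u i * (a i * a i) + (- (ι 2 * t) * (u i * a i) + (Q * D ⁻¹) * u i) ∎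

    pairs : sum (λ i → sum (λ j → u i * u j / D * ((a i - a j) * (a i - a j)))) ≈ ι 2 * Q -
      ι 2 * (D * t * t)
    pairs = begin
      sum (λ i → sum (λ j → u i * u j / D * ((a i - a j) * (a i - a j))))   ≈⟨ sum-cong {n} row ⟩
      sum (λ i → u i * (a i * a i) + (- (ι 2 * t) * (u i * a i) + (Q * D ⁻¹) * u i))
        ≈⟨ trans (sum-+ {n} _ _) (+-congˡ (trans (sum-+ {n} _ _)
             (+-cong (sum-* {n} _ _) (sum-* {n} _ u)))) ⟩
      Q + (- (ι 2 * t) * s + (Q * D ⁻¹) * sum u)
        ≈⟨ +-congˡ (+-cong (*-congˡ (sym Dt≈s))
             (trans (*-congˡ (sym D≈Σu)) (trans (*-assoc _ _ _)
               (trans (*-congˡ (⁻¹-inverseˡ D D≉0)) (*-identityʳ Q))))) ⟩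
      Q + (- (ι 2 * t) * (D * t) + Q)
        ≈⟨ solve 3 (λ Q t D → Q :+ ((:- (con (+ 2) :* t)) :* (D :* t) :+ Q) :=
             con (+ 2) :* Q :- con (+ 2) :* (D :* t :* t)) refl Q t D ⟩
      ι 2 * Q - ι 2 * (D * t * t) ∎

  -- Needed because `h i (y j)` is not symmetric in the two neighbours; only together with its
  -- transpose does it become a square.
  sum-symmetrise : ∀ {n} (F H : Fin n → Fin n → ℝ) → (∀ i j → F i j + F j i ≈ ι 2 * H i j) →
    sum (λ i → sum (λ j → F i j)) ≈ sum (λ i → sum (λ j → H i j))
  sum-symmetrise {n} F H F+Fᵀ = *-cancelˡ-≈ (ι[1+n]≉0 1)
    (trans (solve 1 (λ s → con (+ 2) :* s := s :+ s) refl ΣF) doubled)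
    where
    ΣF ΣH : ℝ
    ΣF = sum (λ i → sum (λ j → F i j))
    ΣH = sum (λ i → sum (λ j → H i j))

    doubled : ΣF + ΣF ≈ ι 2 * ΣH
    doubled = begin
      ΣF + ΣF                                                ≈⟨ +-congˡ (sum-swap {n} {n} F) ⟩
      ΣF + sum (λ i → sum (λ j → F j i))                     ≈⟨ sum-+ {n} _ _ ⟨
      sum (λ i → sum (λ j → F i j) + sum (λ j → F j i))
        ≈⟨ sum-cong {n} (λ i → trans (sym (sum-+ {n} _ _))
             (trans (sum-cong {n} (F+Fᵀ i)) (sum-* {n} (ι 2) _))) ⟩
      sum (λ i → ι 2 * sum (λ j → H i j))                    ≈⟨ sum-* {n} (ι 2) _ ⟩
      ι 2 * ΣH                                               ∎

  module Expand (f : V → ℝ) (D : ℝ) (ι-d⁺≈D : ∀ i → ι (d⁺ (y i)) ≈ D) where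
    a : Vector ℝ d
    a i = f (y i) - f x

    c : V → ℝ
    c z = f z - f x

    defect : V → ℝ
    defect z = c z - ι 2 * (sum (λ i → w (y i) z * a i) / ι (d⁻ z))

    rest : ℝ
    rest = sumOver S₂ (λ z → ι (d⁻ z) * (defect z * defect z))

    -- The share of a neighbour v of yᵢ in 2Γ(f)(yᵢ) - 2aᵢΔf(yᵢ), the part of 4Γ₂(f)(x) that
    -- involves values of `f` beyond S₁(x).
    h : Fin d → V → ℝ
    h i v = (f v - f (y i)) * (f v - f (y i)) - ι 2 * (a i * (f v - f (y i)))

    4Γ₂ : ι 4 * Γ₂ f f x ≈ sum (λ i → sumOver (nbrs (y i)) (h i) + (ι 2 * (a i * sum a) - a ∙ a))
    4Γ₂ = begin
      ι 4 * Γ₂ f f x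
        ≈⟨ solve 1 (λ g → con (+ 4) :* g := con (+ 2) :* (con (+ 2) :* g)) refl (Γ₂ f f x) ⟩
      ι 2 * (ι 2 * Γ₂ f f x)   ≈⟨ *-congˡ (*-/-cancel _ (ι[1+n]≉0 1)) ⟩
      ι 2 * (Δ (Γ f f) x - Γ f (Δ f) x - Γ (Δ f) f x)
        ≈⟨ solve 3 (λ p q r → con (+ 2) :* (p :- q :- r) :=
             (con (+ 2) :* p :- con (+ 2) :* q) :- con (+ 2) :* r)
             refl (Δ (Γ f f) x) (Γ f (Δ f) x) (Γ (Δ f) f x) ⟩
      (ι 2 * Δ (Γ f f) x - ι 2 * Γ f (Δ f) x) - ι 2 * Γ (Δ f) f x
        ≈⟨ +-cong (+-cong (sym (sum-* {d} (ι 2) _)) (-‿cong (2Γ f (Δ f) x))) (-‿cong (2Γ (Δ f) f x)) ⟩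
      (sum (λ i → ι 2 * (Γ f f (y i) - Γ f f x)) - sum (λ i → a i * (Δ f (y i) - Δ f x))) -
        sum (λ i → (Δ f (y i) - Δ f x) * a i)
        ≈⟨ trans (+-congʳ (sym (sum-minus {d} _ _))) (sym (sum-minus {d} _ _)) ⟩
      sum (λ i → (ι 2 * (Γ f f (y i) - Γ f f x) - a i * (Δ f (y i) - Δ f x)) - (Δ f (y i) - Δ f x) * a i)
        ≈⟨ sum-cong {d} term ⟩
      sum (λ i → sumOver (nbrs (y i)) (h i) + (ι 2 * (a i * sum a) - a ∙ a)) ∎
      where
      term : ∀ i → (ι 2 * (Γ f f (y i) - Γ f f x) - a i * (Δ f (y i) - Δ f x)) -
        (Δ f (y i) - Δ f x) * a i ≈
                   sumOver (nbrs (y i)) (h i) + (ι 2 * (a i * sum a) - a ∙ a)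
      term i = begin
        (ι 2 * (Γ f f (y i) - Γ f f x) - a i * (Δ f (y i) - Δ f x)) - (Δ f (y i) - Δ f x) * a i
          ≈⟨ solve 5 (λ g g₀ a δ δ₀ → (con (+ 2) :* (g :- g₀) :- a :* (δ :- δ₀)) :- (δ :- δ₀) :* a :=
               (con (+ 2) :* g :- con (+ 2) :* a :* δ) :+ (con (+ 2) :* (a :* δ₀) :- con (+ 2) :* g₀))
               refl (Γ f f (y i)) (Γ f f x) (a i) (Δ f (y i)) (Δ f x) ⟩
        -- `Δ f x` unfolds to `sum a`, so it can be replaced without an argument.
        (ι 2 * Γ f f (y i) - ι 2 * a i * Δ f (y i)) + (ι 2 * (a i * sum a) - ι 2 * Γ f f x)
          ≈⟨ +-cong (+-cong (2Γ f f (y i)) (-‿cong (sym (sum-* {m} (ι 2 * a i) _))))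
               (+-congˡ (-‿cong (2Γ f f x))) ⟩
        (sumOver (nbrs (y i)) (λ v → (f v - f (y i)) * (f v - f (y i))) -
          sumOver (nbrs (y i)) (λ v → ι 2 * a i * (f v - f (y i)))) + (ι 2 * (a i * sum a) - a ∙ a)
          ≈⟨ +-congʳ (trans (sym (sum-minus {m} _ _))
               (sum-cong {m} (λ k → +-congˡ (-‿cong (*-assoc _ _ _))))) ⟩
        sumOver (nbrs (y i)) (h i) + (ι 2 * (a i * sum a) - a ∙ a) ∎
        where
        m : ℕ
        m = length (nbrs (y i))

    -- The neighbours of yᵢ are x, which contributes 3aᵢ², those in S₁(x), and those in S₂(x), where
    -- `h i z` is (c(z) - 2aᵢ)² - aᵢ². The last square is subtracted d⁺(yᵢ) = D times.
    h-sum : ∀ i → sumOver (nbrs (y i)) (h i) ≈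
      ι 3 * (a i * a i) + (sum (λ j → w (y i) (y j) * h i (y j)) +
        (sumOver S₂ (λ z → w (y i) z * ((c z - ι 2 * a i) * (c z - ι 2 * a i))) - D * (a i * a i)))
    h-sum i = trans (sum-nbrs i (h i)) (+-cong at-x (+-congˡ at-S₂))
      where
      at-x : h i x ≈ ι 3 * (a i * a i)
      at-x = solve 2 (λ p q → (q :- p) :* (q :- p) :- con (+ 2) :* ((p :- q) :* (q :- p)) :=
                              con (+ 3) :* ((p :- q) :* (p :- q))) refl (f (y i)) (f x)

      m : ℕ
      m = length S₂

      at-S₂ : sumOver S₂ (λ z → w (y i) z * h i z) ≈
        sumOver S₂ (λ z → w (y i) z * ((c z - ι 2 * a i) * (c z - ι 2 * a i))) - D * (a i * a i)
      at-S₂ = begin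
        sumOver S₂ (λ z → w (y i) z * h i z)
          ≈⟨ sum-cong {m} (λ k → solve 4 (λ w p q r →
               w :* ((r :- p) :* (r :- p) :- con (+ 2) :* ((p :- q) :* (r :- p))) :=
               w :* (((r :- q) :- con (+ 2) :* (p :- q)) :* ((r :- q) :- con (+ 2) :* (p :- q)))
                 :- ((p :- q) :* (p :- q)) :* w)
                   refl (w (y i) (lookup S₂ k)) (f (y i)) (f x) (f (lookup S₂ k))) ⟩
        sumOver S₂ (λ z → w (y i) z * ((c z - ι 2 * a i) * (c z - ι 2 * a i)) - (a i * a i) * w (y i) z)
          ≈⟨ sum-minus {m} _ _ ⟩
        sumOver S₂ (λ z → w (y i) z * ((c z - ι 2 * a i) * (c z - ι 2 * a i))) -
          sumOver S₂ (λ z → (a i * a i) * w (y i) z)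
          ≈⟨ +-congˡ (-‿cong (trans (sum-* {m} (a i * a i) _)
               (trans (*-congˡ (trans (sym (ι-d⁺ i)) (ι-d⁺≈D i))) (*-comm _ _)))) ⟩
        sumOver S₂ (λ z → w (y i) z * ((c z - ι 2 * a i) * (c z - ι 2 * a i))) - D * (a i * a i) ∎

    -- Adding the transposed term to the one for (i, j) gives 4w(aᵢ - aⱼ)², so symmetrisation leaves
    -- the factor 2.
    sphere₁ : sum (λ i → sum (λ j → w (y i) (y j) * h i (y j))) ≈
              sum (λ i → sum (λ j → ι 2 * (w (y i) (y j) * ((a i - a j) * (a i - a j)))))
    sphere₁ = sum-symmetrise (λ i j → w (y i) (y j) * h i (y j)) _ (λ i j →
      trans (+-congˡ (*-congʳ (w-sym (y j) (y i))))
        (solve 4 (λ w p q r →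
           w :* ((q :- p) :* (q :- p) :- con (+ 2) :* ((p :- r) :* (q :- p))) :+
           w :* ((p :- q) :* (p :- q) :- con (+ 2) :* ((q :- r) :* (p :- q))) :=
           con (+ 2) :* (con (+ 2) :* (w :* (((p :- r) :- (q :- r)) :* ((p :- r) :- (q :- r))))))
           refl (w (y i) (y j)) (f (y i)) (f (y j)) (f x)))

    -- Summed over S₁(x) first, each z gives a weighted variance whose pair coefficients are w(yᵢ,
    -- z)w(z, yⱼ)/d⁻(z). Their sum over z is `w′`, which is how these weights arise.
    sphere₂ : sum (λ i → sumOver S₂ (λ z → w (y i) z * ((c z - ι 2 * a i) * (c z - ι 2 * a i)))) ≈
              ι 2 * sum (λ i → sum (λ j → w′ i j * ((a i - a j) * (a i - a j)))) + rest
    sphere₂ = begin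
      sum (λ i → sumOver S₂ (λ z → w (y i) z * ((c z - ι 2 * a i) * (c z - ι 2 * a i))))
        ≈⟨ sum-swap {d} {m} _ ⟩
      sumOver S₂ (λ z → sum (λ i → w (y i) z * ((c z - ι 2 * a i) * (c z - ι 2 * a i))))
        ≈⟨ sum-cong {m} (λ k → variance (λ i → w (y i) (z k)) a (c (z k)) (ι (d⁻ (z k)))
             (ι-d⁻≉0 (∈-lookup {xs = S₂} k)) (ι-d⁻ (z k))) ⟩
      sumOver S₂ (λ z → ι 2 * sum (λ i →
        sum (λ j → w (y i) z * w (y j) z / ι (d⁻ z) * ((a i - a j) * (a i - a j))))
                        + ι (d⁻ z) * (defect z * defect z))
        ≈⟨ trans (sum-+ {m} _ _) (+-congʳ (trans (sum-* {m} (ι 2) _) (*-congˡ regroup))) ⟩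
      ι 2 * sum (λ i → sum (λ j → w′ i j * ((a i - a j) * (a i - a j)))) + rest ∎
      where
      m : ℕ
      m = length S₂

      z : Fin m → V
      z = lookup S₂

      regroup : sumOver S₂ (λ z →
        sum (λ i → sum (λ j → w (y i) z * w (y j) z / ι (d⁻ z) * ((a i - a j) * (a i - a j))))) ≈
                sum (λ i → sum (λ j → w′ i j * ((a i - a j) * (a i - a j))))
      regroup = trans (sum-swap {m} {d} _)
        (sum-cong {d} (λ i → trans (sum-swap {m} {d} _) (sum-cong {d} (λ j →
        trans (sum-cong {m} (λ k → trans (*-comm _ _) (*-congˡ (*-congʳ (*-congˡ (w-sym (y j) (z k)))))))
          (trans (sum-* {m} ((a i - a j) * (a i - a j)) _) (*-comm _ _))))))

    -- In the coefficient of |a|², 3 comes from the neighbour x, -d from the d copies of -2Γ(f)(x),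
    -- and -D from S₂(x). Both spheres yield a Dirichlet sum with the same factor 2, so `w` and `w′`
    -- combine into `w″`.
    4Γ₂-form : ι 4 * Γ₂ f f x ≈
      (((ι 3 - ι d) - D) * a ∙ a + ι 2 * (sum a * sum a)) + ι 2 * q a + rest
    4Γ₂-form = begin
      ι 4 * Γ₂ f f x    ≈⟨ 4Γ₂ ⟩
      sum (λ i → sumOver (nbrs (y i)) (h i) + (ι 2 * (a i * sum a) - a ∙ a))
        ≈⟨ trans (sum-+ {d} _ _) (+-cong (sum-cong {d} h-sum) (trans (sum-minus {d} _ _)
             (+-cong (trans (sum-* {d} (ι 2) _) (*-congˡ
               (trans (sum-cong {d} (λ i → *-comm (a i) (sum a))) (sum-* {d} (sum a) a))))
                 (-‿cong (sum-const d (a ∙ a)))))) ⟩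
      sum (λ i → ι 3 * (a i * a i) + (sum (λ j → w (y i) (y j) * h i (y j)) +
        (sumOver S₂ (λ z → w (y i) z * ((c z - ι 2 * a i) * (c z - ι 2 * a i))) - D * (a i * a i))))
        + (ι 2 * (sum a * sum a) - ι d * a ∙ a)
        ≈⟨ +-congʳ (trans (sum-+ {d} _ _)
             (+-cong (sum-* {d} (ι 3) _) (trans (sum-+ {d} _ _) (+-cong (trans sphere₁ pull₂)
             (trans (sum-minus {d} _ _) (+-cong sphere₂ (-‿cong (sum-* {d} D _)))))))) ⟩
      (ι 3 * a ∙ a + (ι 2 * q₁ + ((ι 2 * q₂ + rest) - D * a ∙ a))) + (ι 2 * (sum a * sum a) - ι d * a ∙ a)
        ≈⟨ solve 7 (λ A q₁ q₂ r D s n →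
             (con (+ 3) :* A :+ (con (+ 2) :* q₁ :+ ((con (+ 2) :* q₂ :+ r) :- D :* A))) :+
               (con (+ 2) :* (s :* s) :- n :* A) :=
             (((con (+ 3) :- n) :- D) :* A :+ con (+ 2) :* (s :* s)) :+ con (+ 2) :* (q₁ :+ q₂) :+ r)
             refl (a ∙ a) q₁ q₂ rest D (sum a) (ι d) ⟩
      (((ι 3 - ι d) - D) * a ∙ a + ι 2 * (sum a * sum a)) + ι 2 * (q₁ + q₂) + rest
        ≈⟨ +-congʳ (+-congˡ (*-congˡ q₁+q₂)) ⟩
      (((ι 3 - ι d) - D) * a ∙ a + ι 2 * (sum a * sum a)) + ι 2 * q a + rest ∎
      where
      q₁ q₂ : ℝ
      q₁ = sum (λ i → sum (λ j → w (y i) (y j) * ((a i - a j) * (a i - a j))))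
      q₂ = sum (λ i → sum (λ j → w′ i j * ((a i - a j) * (a i - a j))))

      pull₂ : sum (λ i → sum (λ j → ι 2 * (w (y i) (y j) * ((a i - a j) * (a i - a j))))) ≈ ι 2 * q₁
      pull₂ = trans (sum-cong {d} (λ i → sum-* {d} (ι 2) _)) (sum-* {d} (ι 2) _)

      q₁+q₂ : q₁ + q₂ ≈ q a
      q₁+q₂ = trans (sym (sum-+ {d} _ _)) (sum-cong {d} (λ i → trans (sym (sum-+ {d} _ _))
        (sum-cong {d} (λ j → sym (distribʳ _ _ _)))))

  -- The curvature-dimension inequality as nonnegativity of a quadratic form.

  module CurvatureDimension (D : ℝ) (ι-d⁺≈D : ∀ i → ι (d⁺ (y i)) ≈ D) where

    -- `α` and `β` are the coefficients of |a|² and (Σaᵢ)² in 4(Γ₂(f) - (Δf)²/𝒩 - KΓ(f))(x); here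
    -- 4KΓ(f)(x) = 2K|a|².
    α : ℝ → ℝ
    α K = ((ι 3 - ι d) - D) - ι 2 * K

    β : ℝ ⁺ → ℝ
    β 𝒩 = ι 2 - ι 4 * recip 𝒩

    CD-gap : ∀ 𝒩 K f → let open Expand f D ι-d⁺≈D in
      ι 4 * (Γ₂ f f x - (recip 𝒩 * (Δ f x * Δ f x) + K * Γ f f x)) ≈ Form (α K) (β 𝒩) a + rest
    CD-gap 𝒩 K f = begin
      ι 4 * (Γ₂ f f x - (r * (sum a * sum a) + K * Γ f f x))
        ≈⟨ solve 5 (λ g r t k c → con (+ 4) :* (g :- (r :* t :+ k :* c)) :=
             con (+ 4) :* g :- (con (+ 4) :* r :* t :+ con (+ 2) :* k :* (con (+ 2) :* c)))
             refl (Γ₂ f f x) r (sum a * sum a) K (Γ f f x) ⟩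
      ι 4 * Γ₂ f f x - (ι 4 * r * (sum a * sum a) + ι 2 * K * (ι 2 * Γ f f x))
        ≈⟨ +-cong 4Γ₂-form (-‿cong (+-congˡ (*-congˡ (2Γ f f x)))) ⟩
      ((((ι 3 - ι d) - D) * a ∙ a + ι 2 * (sum a * sum a)) + ι 2 * q a + rest) -
        (ι 4 * r * (sum a * sum a) + ι 2 * K * a ∙ a)
        ≈⟨ solve 7 (λ e A t q ρ r k →
             ((e :* A :+ con (+ 2) :* t) :+ con (+ 2) :* q :+ ρ) :-
               (con (+ 4) :* r :* t :+ con (+ 2) :* k :* A) :=
             (((e :- con (+ 2) :* k) :* A :+ (con (+ 2) :- con (+ 4) :* r) :* t) :+ con (+ 2) :* q) :+ ρ)
             refl ((ι 3 - ι d) - D) (a ∙ a) (sum a * sum a) (q a) rest r K ⟩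
      Form (α K) (β 𝒩) a + rest ∎
      where
      open Expand f D ι-d⁺≈D
      r : ℝ
      r = recip 𝒩

    -- On the 2-sphere the extension takes the values that minimise Γ₂.
    extend : Vector ℝ d → V → ℝ
    extend a v with em {x ≡ v} | em {v ∈ nbrs x}
    ... | yes _ | _      = 0#
    ... | no _  | yes v∈ = a (Any.index v∈)
    ... | no _  | no _   = ι 2 * (sum (λ i → w (y i) v * a i) / ι (d⁻ v))

    extend-x : ∀ a → extend a x ≈ 0#
    extend-x a with em {x ≡ x}
    ... | yes _  = refl
    ... | no x≢x = contradiction ≡.refl x≢x

    extend-y : ∀ a i → extend a (y i) ≈ a i
    extend-y a i with em {x ≡ y i} | em {y i ∈ nbrs x}
    ... | yes x≡y | _       = contradiction (x~y i) (~-irrefl x≡y)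
    ... | no _    | no y∉   = contradiction (∈-lookup i) y∉
    -- The membership proof is an arbitrary one; since `nbrs x` has no repetitions, its index must
    -- still be `i`.
    ... | no _    | yes y∈  = reflexive (≡.cong a
      (lookup-injective (nbrs-uniq x) _ _ (≡.sym (lookup-index y∈))))

    extend-z : ∀ a {z} → S 2 x z → extend a z ≈ ι 2 * (sum (λ i → w (y i) z * a i) / ι (d⁻ z))
    extend-z a {z} z∈S₂ with em {x ≡ z} | em {z ∈ nbrs x}
    ... | yes x≡z | _       = contradiction x≡z (S₂⇒≢ z∈S₂)
    ... | no _    | yes z∈  = contradiction (∈-nbrs⁻ z∈) (S₂⇒≁ z∈S₂)
    ... | no _    | no _    = refl

    CD⇒0≤Form : ∀ {𝒩 K} → CD x 𝒩 K → ∀ a → 0# ≤ Form (α K) (β 𝒩) a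
    CD⇒0≤Form {𝒩} {K} cd b = ≤-respʳ (begin
      ι 4 * (Γ₂ f f x - (recip 𝒩 * (Δ f x * Δ f x) + K * Γ f f x))   ≈⟨ CD-gap 𝒩 K f ⟩
      Form (α K) (β 𝒩) a + rest    ≈⟨ +-cong (Form-cong a≈b) rest≈0 ⟩
      Form (α K) (β 𝒩) b + 0#      ≈⟨ +-identityʳ _ ⟩
      Form (α K) (β 𝒩) b           ∎) (*-nonNeg (0≤ι 4) (≤⇒0≤- (cd f)))
      where
      f : V → ℝ
      f = extend b

      open Expand f D ι-d⁺≈D

      minus-fx : ∀ {v t} → f v ≈ t → f v - f x ≈ t
      minus-fx {v} {t} eq = trans (+-cong eq (-‿cong (extend-x b)))
        (solve 1 (λ t → t :- con (+ 0) := t) refl t)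

      a≈b : ∀ i → a i ≈ b i
      a≈b i = minus-fx (extend-y b i)

      rest≈0 : rest ≈ 0#
      rest≈0 = sum-zero {length S₂} (λ k → let z∈S₂ = ∈-lookup {xs = S₂} k in
        trans (*-congˡ (trans (*-congʳ (defect≈0 (∈-S₂⁻ z∈S₂))) (zeroˡ _))) (zeroʳ _))
        where
        defect≈0 : ∀ {z} → S 2 x z → defect z ≈ 0#
        defect≈0 {z} s = trans (+-congʳ (minus-fx (extend-z b s)))
          (trans (+-congˡ (-‿cong (*-congˡ (*-congʳ (sum-cong {d} (λ i → *-congˡ (a≈b i)))))))
            (-‿inverseʳ _))

    0≤Form⇒CD : ∀ {𝒩 K} → (∀ a → 0# ≤ Form (α K) (β 𝒩) a) → CD x 𝒩 K
    0≤Form⇒CD {𝒩} {K} h f = 0≤-⇒≤ (*-cancelˡ-0≤ (0<ι[1+n] 3)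
      (≤-respʳ (sym (CD-gap 𝒩 K f)) (0≤+ (h a) 0≤rest)))
      where
      open Expand f D ι-d⁺≈D using (a; rest; defect)
      0≤rest : 0# ≤ rest
      0≤rest = 0≤sum {length S₂} (λ k → *-nonNeg (0≤ι (d⁻ (lookup S₂ k))) (0≤x*x _))

  -- An orthogonal eigenbasis from the multiplicities.

  module Spectrum (2≤d : 2 ℕ.≤ d) (λs : Vector ℝ d) (spectrum : IsSpectrum λs) where
    open IsSpectrum spectrum
    open HasDimension

    -- Its length is the dimension prescribed by `IsSpectrum`, so positions in this list number a
    -- basis of the eigenspace of `μ`.
    indices : ℝ → List (Fin d)
    indices μ = filter (λ i → em {λs i ≈ μ}) (allFin d)

    ∈-indices : ∀ {μ} k → λs k ≈ μ → k ∈ indices μ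
    ∈-indices {μ} k eq = ∈-filter⁺ (λ i → em {λs i ≈ μ}) (∈-allFin k) eq

    indices-cong : ∀ {μ ν} → μ ≈ ν → indices μ ≡ indices ν
    indices-cong {μ} {ν} μ≈ν = filter-≐ (λ i → em {λs i ≈ μ}) (λ i → em {λs i ≈ ν})
      ((λ eq → trans eq μ≈ν) , (λ eq → trans eq (sym μ≈ν))) (allFin d)

    abstract
      orthogonal-basis : ∀ μ → ∃[ v ] (∀ k → Eigen μ (v k)) × Orthogonal {length (indices μ)} v
      orthogonal-basis μ = gram-schmidt (Eigen μ) Eigen-linear
        (basis (multiplicity μ)) (member (multiplicity μ)) (independent (multiplicity μ))

    -- Indices of equal eigenvalues must share one eigenbasis; since the eigenvalues
    -- are compared by ≈ only, it is that of the first such index.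
    first : List (Fin d) → Fin d → Fin d
    first []      k = k
    first (i ∷ _) _ = i

    first-irrelevant : ∀ {is k l} → k ∈ is → first is k ≡ first is l
    first-irrelevant {_ ∷ _} _ = ≡.refl

    first-∈ : ∀ {is k} → k ∈ is → first is k ∈ is
    first-∈ {_ ∷ _} _ = here ≡.refl

    representative : Fin d → Fin d
    representative k = first (indices (λs k)) k

    representative-cong : ∀ {k l} → λs k ≈ λs l → representative k ≡ representative l
    representative-cong {k} {l} eq = ≡.trans
      (first-irrelevant (∈-indices k refl)) (≡.cong (λ is → first is l) (indices-cong eq))

    λs-representative : ∀ k → λs (representative k) ≈ λs k
    λs-representative k = proj₂ (∈-filter⁻ (λ i → em {λs i ≈ λs k}) {xs = allFin d}
      (first-∈ (∈-indices k refl)))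

    position : ∀ k → k ∈ indices (λs (representative k))
    position k = ∈-indices k (sym (λs-representative k))

    eigenvector : ∀ {k} r → k ∈ indices (λs r) → Vector ℝ d
    eigenvector r k∈ = proj₁ (orthogonal-basis (λs r)) (Any.index k∈)

    eigenvector-Eigen : ∀ {k} r (k∈ : k ∈ indices (λs r)) → Eigen (λs r) (eigenvector r k∈)
    eigenvector-Eigen r k∈ = proj₁ (proj₂ (orthogonal-basis (λs r))) (Any.index k∈)

    -- Once the representatives are identified, both vectors come from the same Gram-Schmidt basis,
    -- and different indices have different positions in the list.
    eigenvectors-orthogonal : ∀ {k l r s} (k∈ : k ∈ indices (λs r)) (l∈ : l ∈ indices (λs s)) →
      r ≡ s → k ≢ l → eigenvector r k∈ ∙ eigenvector s l∈ ≈ 0#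
    eigenvectors-orthogonal {r = r} k∈ l∈ ≡.refl k≢l =
      Orthogonal.orthogonal (proj₂ (proj₂ (orthogonal-basis (λs r)))) _ _ (λ eq → k≢l
        (≡.trans (lookup-index k∈) (≡.trans (≡.cong (lookup (indices (λs r))) eq)
          (≡.sym (lookup-index l∈)))))

    -- Each index takes, from the basis of its eigenspace, the vector at its own position among the
    -- indices of that eigenvalue. Orthogonality comes from Gram-Schmidt within an eigenspace and
    -- from self-adjointness across eigenspaces.
    v : Vector (Vector ℝ d) d
    v k = eigenvector (representative k) (position k)

    v-Eigen : ∀ k → Eigen (λs k) (v k)
    v-Eigen k = Eigen-resp (λs-representative k) (eigenvector-Eigen (representative k) (position k))

    v-orthogonal : Orthogonal v
    v-orthogonal = record
      { nonzero    = λ k → Orthogonal.nonzero (proj₂ (proj₂ (orthogonal-basis (λs (representative k))))) _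
      ; orthogonal = orthogonal
      }
      where
      orthogonal : ∀ k l → k ≢ l → v k ∙ v l ≈ 0#
      orthogonal k l k≢l with em {λs k ≈ λs l}
      ... | yes eq = eigenvectors-orthogonal (position k) (position l) (representative-cong eq) k≢l
      ... | no neq = Eigen-orthogonal (v-Eigen k) (v-Eigen l) neq

    0<d : 0 ℕ.< d
    0<d = ℕ.≤-trans (s≤s z≤n) 2≤d

    k₀ k₁ : Fin d
    k₀ = fromℕ< 0<d
    k₁ = fromℕ< 2≤d

    toℕ-k₀ : toℕ k₀ ≡ 0
    toℕ-k₀ = Fin.toℕ-fromℕ< 0<d

    toℕ-k₁ : toℕ k₁ ≡ 1
    toℕ-k₁ = Fin.toℕ-fromℕ< 2≤d

    k₀≢k₁ : k₀ ≢ k₁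
    k₀≢k₁ eq with ≡.trans (≡.sym toℕ-k₀) (≡.trans (≡.cong toℕ eq) toℕ-k₁)
    ... | ()

    λs-least : ∀ k → λs k₀ ≤ λs k
    λs-least k = ordered k₀ k (≡.subst (ℕ._≤ toℕ k) (≡.sym toℕ-k₀) z≤n)

    λs-second : ∀ k → k ≡ k₀ ⊎ λs k₁ ≤ λs k
    λs-second k with toℕ k in eq
    ... | zero  = inj₁ (Fin.toℕ-injective (≡.trans eq (≡.sym toℕ-k₀)))
    ... | suc n = inj₂ (ordered k₁ k (≡.subst₂ ℕ._≤_ (≡.sym toℕ-k₁) (≡.sym eq) (s≤s z≤n)))

    open SpectralGap λs v v-orthogonal v-Eigen k₀ k₁ k₀≢k₁ λs-least λs-second public
      using (λ₁; 0≤Form⁺; 0≤Form⁻)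

  -- Comparison of the two bounds.

  module Curvatures (out-regular : S₁-OutRegular) (2≤d : 2 ℕ.≤ d)
    (λs : Vector ℝ d) (spectrum : IsSpectrum λs) where
    open Spectrum 2≤d λs spectrum

    ι-d⁺≈av₁⁺ : ∀ i → ι (d⁺ (y i)) ≈ av₁⁺
    ι-d⁺≈av₁⁺ i = *-cancelˡ-≈ (proj₂ (0<ι k₀) ∘ sym) (begin
      ι d * ι (d⁺ (y i))              ≈⟨ sum-const d _ ⟨
      sum {d} (λ _ → ι (d⁺ (y i)))    ≈⟨ sum-cong {d} (λ j → reflexive (≡.cong ι (out-regular i j))) ⟩
      sum (λ j → ι (d⁺ (y j)))        ≈⟨ *-/-cancel _ (proj₂ (0<ι k₀) ∘ sym) ⟨
      ι d * av₁⁺                      ∎)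

    open CurvatureDimension av₁⁺ ι-d⁺≈av₁⁺

    -- The bounds on the curvature given by the constant functions on S₁(x) and by
    -- the eigenfunctions of λ₁.
    κ : ℝ ⁺ → ℝ
    κ 𝒩 = (ι 3 + ι d - av₁⁺) / ι 2 - (ι 2 * ι d) * recip 𝒩

    κ₁ : ℝ
    κ₁ = (ι 3 - ι d - av₁⁺) / ι 2 + ι 2 * λ₁

    -- This and `2[κ₁-K]` turn the two sign conditions of `0≤Form⁺` and `0≤Form⁻` into upper bounds
    -- on `K`.
    2[κ-K] : ∀ 𝒩 K → α K + β 𝒩 * ι d ≈ ι 2 * (κ 𝒩 - K)
    2[κ-K] 𝒩 K = begin
      α K + β 𝒩 * ι d
        ≈⟨ solve 4 (λ n D k r → ((con (+ 3) :- n) :- D) :- con (+ 2) :* k :+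
             (con (+ 2) :- con (+ 4) :* r) :* n :=
             (con (+ 3) :+ n :- D) :- con (+ 2) :* (con (+ 2) :* n :* r :+ k))
               refl (ι d) av₁⁺ K (recip 𝒩) ⟩
      (ι 3 + ι d - av₁⁺) - ι 2 * (ι 2 * ι d * recip 𝒩 + K)
        ≈⟨ +-congʳ (*-/-cancel (ι 3 + ι d - av₁⁺) (ι[1+n]≉0 1)) ⟨
      ι 2 * ((ι 3 + ι d - av₁⁺) / ι 2) - ι 2 * (ι 2 * ι d * recip 𝒩 + K)
        ≈⟨ solve 3 (λ h u k → con (+ 2) :* h :- con (+ 2) :* (u :+ k) := con (+ 2) :* (h :- u :- k))
             refl ((ι 3 + ι d - av₁⁺) / ι 2) (ι 2 * ι d * recip 𝒩) K ⟩
      ι 2 * (κ 𝒩 - K) ∎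

    2[κ₁-K] : ∀ K → α K + ι 4 * λ₁ ≈ ι 2 * (κ₁ - K)
    2[κ₁-K] K = begin
      α K + ι 4 * λ₁
        ≈⟨ solve 3 (λ e k l → e :- con (+ 2) :* k :+ con (+ 4) :* l :=
             e :+ con (+ 2) :* (con (+ 2) :* l :- k))
             refl ((ι 3 - ι d) - av₁⁺) K λ₁ ⟩
      (ι 3 - ι d - av₁⁺) + ι 2 * (ι 2 * λ₁ - K)
        ≈⟨ +-congʳ (*-/-cancel (ι 3 - ι d - av₁⁺) (ι[1+n]≉0 1)) ⟨
      ι 2 * ((ι 3 - ι d - av₁⁺) / ι 2) + ι 2 * (ι 2 * λ₁ - K)
        ≈⟨ solve 3 (λ h l k → con (+ 2) :* h :+ con (+ 2) :* (con (+ 2) :* l :- k) :=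
             con (+ 2) :* ((h :+ con (+ 2) :* l) :- k))
             refl ((ι 3 - ι d - av₁⁺) / ι 2) λ₁ K ⟩
      ι 2 * (κ₁ - K) ∎

    CD⇒≤ : ∀ {𝒩 K} → CD x 𝒩 K → K ≤ κ 𝒩 × K ≤ κ₁
    CD⇒≤ {𝒩} {K} cd = halve (2[κ-K] 𝒩 K) (proj₂ bounds) , halve (2[κ₁-K] K) (proj₁ bounds)
      where
      bounds : 0# ≤ α K + ι 4 * λ₁ × 0# ≤ α K + β 𝒩 * ι d
      bounds = 0≤Form⁻ (CD⇒0≤Form {𝒩} {K} cd)

      halve : ∀ {t u} → t ≈ ι 2 * (u - K) → 0# ≤ t → K ≤ u
      halve eq 0≤t = 0≤-⇒≤ (*-cancelˡ-0≤ (0<ι[1+n] 1) (≤-respʳ eq 0≤t))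

    ≤⇒CD : ∀ {𝒩 K} → K ≤ κ 𝒩 → K ≤ κ₁ → CD x 𝒩 K
    ≤⇒CD {𝒩} {K} K≤κ K≤κ₁ = 0≤Form⇒CD {𝒩} {K} (0≤Form⁺
      (≤-respʳ (sym (2[κ₁-K] K)) (*-nonNeg (0≤ι 2) (≤⇒0≤- K≤κ₁)))
      (≤-respʳ (sym (2[κ-K] 𝒩 K)) (*-nonNeg (0≤ι 2) (≤⇒0≤- K≤κ))))

    curvature-κ : ∀ {𝒩} → κ 𝒩 ≤ κ₁ → IsCurvature x 𝒩 (κ 𝒩)
    curvature-κ {𝒩} κ≤κ₁ = ≤⇒CD {𝒩} (≤-reflexive refl) κ≤κ₁ , λ K cd → proj₁ (CD⇒≤ {𝒩} cd)

    curvature-κ₁ : ∀ {𝒩} → κ₁ ≤ κ 𝒩 → IsCurvature x 𝒩 κ₁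
    curvature-κ₁ {𝒩} κ₁≤κ = ≤⇒CD {𝒩} κ₁≤κ (≤-reflexive refl) , λ K cd → proj₂ (CD⇒≤ {𝒩} cd)

    -- This is `κ ⊤⁺` minus `κ₁`. Its sign separates the two cases of the theorem, and in the second
    -- case the bounds cross where 2d/𝒩 equals it.
    excess : ℝ
    excess = ι d - ι 2 * λ₁

    κ₁-κ : ∀ 𝒩 → ι 2 * ι d * recip 𝒩 - excess ≈ κ₁ - κ 𝒩
    κ₁-κ 𝒩 = *-cancelˡ-≈ (ι[1+n]≉0 1) (begin
      ι 2 * (ι 2 * ι d * recip 𝒩 - excess)
        ≈⟨ solve 4 (λ n r l D → con (+ 2) :* (con (+ 2) :* n :* r :- (n :- con (+ 2) :* l)) :=
             (((con (+ 3) :- n) :- D) :- con (+ 2) :* con (+ 0) :+ con (+ 4) :* l) :-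
             (((con (+ 3) :- n) :- D) :- con (+ 2) :* con (+ 0) :+ (con (+ 2) :- con (+ 4) :* r) :* n))
             refl (ι d) (recip 𝒩) λ₁ av₁⁺ ⟩
      -- The two bounds are compared through the instances at `K = 0#`, where the common term `α 0#`
      -- cancels.
      (α 0# + ι 4 * λ₁) - (α 0# + β 𝒩 * ι d)   ≈⟨ +-cong (2[κ₁-K] 0#) (-‿cong (2[κ-K] 𝒩 0#)) ⟩
      ι 2 * (κ₁ - 0#) - ι 2 * (κ 𝒩 - 0#)
        ≈⟨ solve 2 (λ a b → con (+ 2) :* (a :- con (+ 0)) :- con (+ 2) :* (b :- con (+ 0)) :=
             con (+ 2) :* (a :- b)) refl κ₁ (κ 𝒩) ⟩
      ι 2 * (κ₁ - κ 𝒩) ∎)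

    κ≤κ₁⁺ : ∀ {𝒩} → excess ≤ ι 2 * ι d * recip 𝒩 → κ 𝒩 ≤ κ₁
    κ≤κ₁⁺ {𝒩} h = 0≤-⇒≤ (≤-respʳ (κ₁-κ 𝒩) (≤⇒0≤- h))

    κ≤κ₁⁻ : ∀ {𝒩} → κ 𝒩 ≤ κ₁ → excess ≤ ι 2 * ι d * recip 𝒩
    κ≤κ₁⁻ {𝒩} h = 0≤-⇒≤ (≤-respʳ (sym (κ₁-κ 𝒩)) (≤⇒0≤- h))

    κ₁≤κ : ∀ {𝒩} → ι 2 * ι d * recip 𝒩 ≤ excess → κ₁ ≤ κ 𝒩
    κ₁≤κ {𝒩} h = 0≤-⇒≤ (≤-respʳ (begin
      excess - ι 2 * ι d * recip 𝒩         ≈⟨ solve 2 (λ a b → a :- b := :- (b :- a)) refl excess _ ⟩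
      - (ι 2 * ι d * recip 𝒩 - excess)     ≈⟨ -‿cong (κ₁-κ 𝒩) ⟩
      - (κ₁ - κ 𝒩)                         ≈⟨ solve 2 (λ a b → :- (a :- b) := b :- a) refl κ₁ (κ 𝒩) ⟩
      κ 𝒩 - κ₁                             ∎) (≤⇒0≤- h))

    2[λ₁-d/2] : ι 2 * (λ₁ - ι d / ι 2) ≈ - excess
    2[λ₁-d/2] = begin
      ι 2 * (λ₁ - ι d / ι 2)
        ≈⟨ solve 2 (λ l h → con (+ 2) :* (l :- h) := con (+ 2) :* l :- con (+ 2) :* h)
           refl λ₁ (ι d / ι 2) ⟩
      ι 2 * λ₁ - ι 2 * (ι d / ι 2)      ≈⟨ +-congˡ (-‿cong (*-/-cancel (ι d) (ι[1+n]≉0 1))) ⟩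
      ι 2 * λ₁ - ι d
        ≈⟨ solve 2 (λ l n → con (+ 2) :* l :- n := :- (n :- con (+ 2) :* l)) refl λ₁ (ι d) ⟩
      - excess                          ∎

    d/2≤λ₁⇒excess≤0 : ι d / ι 2 ≤ λ₁ → excess ≤ 0#
    d/2≤λ₁⇒excess≤0 h = 0≤-⇒≤0 (≤-respʳ 2[λ₁-d/2] (*-nonNeg (0≤ι 2) (≤⇒0≤- h)))

    excess≤0⇒d/2≤λ₁ : excess ≤ 0# → ι d / ι 2 ≤ λ₁
    excess≤0⇒d/2≤λ₁ h = 0≤-⇒≤ (*-cancelˡ-0≤ (0<ι[1+n] 1) (≤-respʳ (sym 2[λ₁-d/2]) (≤0⇒0≤- h)))

    λ₁<d/2⇒0<excess : λ₁ < ι d / ι 2 → 0# < excess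
    λ₁<d/2⇒0<excess (λ₁≤d/2 , λ₁≉d/2) with ≤-total 0# excess
    ... | inj₁ 0≤e = 0≤e , λ 0≈e → λ₁≉d/2 (≤-antisym λ₁≤d/2 (excess≤0⇒d/2≤λ₁ (≤-reflexive (sym 0≈e))))
    ... | inj₂ e≤0 = contradiction (≤-antisym λ₁≤d/2 (excess≤0⇒d/2≤λ₁ e≤0)) λ₁≉d/2

    0≤recip : ∀ {𝒩} → [ 0# ] <⁺ 𝒩 → 0# ≤ recip 𝒩
    0≤recip {[ N ]} SupremumStrict.[ 0<N ] = 0≤⁻¹ 0<N
    0≤recip {⊤⁺}    _                      = ≤-reflexive refl

    κ∞ : (ι 3 + ι d - av₁⁺) / ι 2 ≈ κ ⊤⁺
    κ∞ = solve 2 (λ h n → h := h :- (con (+ 2) :* n) :* con (+ 0)) refl _ (ι d)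

    IsCurvature-resp : ∀ {𝒩 K L} → K ≈ L → IsCurvature x 𝒩 K → IsCurvature x 𝒩 L
    IsCurvature-resp {𝒩} K≈L (cd , greatest) =
      (λ f → ≤-respˡ (+-congˡ (*-congʳ K≈L)) (cd f)) , λ M cdM → ≤-respʳ K≈L (greatest M cdM)

    excess∞ : ι 2 * ι d * recip ⊤⁺ ≈ 0#
    excess∞ = zeroʳ _

    -- `κ ⊤⁺` always bounds the admissible constants. It is itself admissible exactly when the other
    -- bound `κ₁` permits it, which is `excess ≤ 0#`.
    sharp : ι d / ι 2 ≤ λ₁ ⇔ ∞-CurvatureSharp
    sharp = mk⇔
      (λ h → IsCurvature-resp {⊤⁺} (sym κ∞) (curvature-κ {⊤⁺}
        (κ≤κ₁⁺ {⊤⁺} (≤-respʳ (sym excess∞) (d/2≤λ₁⇒excess≤0 h)))))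
      (λ s → excess≤0⇒d/2≤λ₁ (≤-respʳ excess∞ (κ≤κ₁⁻ {⊤⁺}
        (proj₂ (CD⇒≤ {⊤⁺} (proj₁ (IsCurvature-resp {⊤⁺} κ∞ s)))))))

    curvature-sharp : ι d / ι 2 ≤ λ₁ → ∀ 𝒩 → [ 0# ] <⁺ 𝒩 → IsCurvature x 𝒩 (κ 𝒩)
    curvature-sharp h 𝒩 0<𝒩 = curvature-κ {𝒩} (κ≤κ₁⁺ {𝒩} (≤-trans (d/2≤λ₁⇒excess≤0 h)
      (*-nonNeg (*-nonNeg (0≤ι 2) (0≤ι d)) (0≤recip 0<𝒩))))

    threshold : ℝ
    threshold = (ι 2 * ι d) / excess

    -- Hence excess ≤ 2d/N exactly when N ≤ 2d/excess.
    excess-N : ∀ {N} → 0# < excess → 0# < N →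
      N * (ι 2 * ι d * N ⁻¹ - excess) ≈ excess * (threshold - N)
    excess-N {N} (_ , 0≉e) (_ , 0≉N) = begin
      N * (ι 2 * ι d * N ⁻¹ - excess)
        ≈⟨ solve 3 (λ N t e → N :* (t :- e) := N :* t :- e :* N) refl N (ι 2 * ι d * N ⁻¹) excess ⟩
      N * (ι 2 * ι d / N) - excess * N           ≈⟨ +-congʳ (*-/-cancel _ (0≉N ∘ sym)) ⟩
      ι 2 * ι d - excess * N                     ≈⟨ +-congʳ (*-/-cancel _ (0≉e ∘ sym)) ⟨
      excess * threshold - excess * N
        ≈⟨ solve 3 (λ e t N → e :* t :- e :* N := e :* (t :- N)) refl excess threshold N ⟩
      excess * (threshold - N)                   ∎

    -- `⊤⁺` cannot lie below a finite threshold, so only finite dimensions occur, and the comparison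
    -- may be multiplied by N > 0.
    curvature-low : λ₁ < ι d / ι 2 → ∀ 𝒩 → [ 0# ] <⁺ 𝒩 → 𝒩 ≤⁺ [ threshold ] → IsCurvature x 𝒩 (κ 𝒩)
    curvature-low h [ N ] SupremumStrict.[ 0<N ] SupremumNonStrict.[ N≤t ] =
      curvature-κ {[ N ]} (κ≤κ₁⁺ {[ N ]} (0≤-⇒≤ (*-cancelˡ-0≤ 0<N
        (≤-respʳ (sym (excess-N 0<e 0<N)) (*-nonNeg (proj₁ 0<e) (≤⇒0≤- N≤t))))))
      where
      0<e : 0# < excess
      0<e = λ₁<d/2⇒0<excess h

    curvature-high : λ₁ < ι d / ι 2 → ∀ 𝒩 → [ 0# ] <⁺ 𝒩 → [ threshold ] <⁺ 𝒩 → IsCurvature x 𝒩 κ₁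
    -- At infinite dimension 2d/𝒩 is read as zero, so positivity of `excess` is already the
    -- comparison.
    curvature-high h ⊤⁺ _ _ = curvature-κ₁ {⊤⁺}
      (κ₁≤κ {⊤⁺} (≤-respˡ (sym excess∞) (proj₁ (λ₁<d/2⇒0<excess h))))
    curvature-high h [ N ] SupremumStrict.[ 0<N ] SupremumStrict.[ t≤N , _ ] =
      curvature-κ₁ {[ N ]} (κ₁≤κ {[ N ]} (0≤-⇒≤ (*-cancelˡ-0≤ 0<N
        (≤-respʳ (begin
          excess * (N - threshold)
            ≈⟨ solve 3 (λ e t N → e :* (N :- t) := :- (e :* (t :- N))) refl excess threshold N ⟩
          - (excess * (threshold - N))           ≈⟨ -‿cong (excess-N 0<e 0<N) ⟨
          - (N * (ι 2 * ι d * N ⁻¹ - excess))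
            ≈⟨ solve 3 (λ N t e → :- (N :* (t :- e)) := N :* (e :- t)) refl N _ excess ⟩
          N * (excess - ι 2 * ι d * N ⁻¹)        ∎) (*-nonNeg (proj₁ 0<e) (≤⇒0≤- t≤N))))))
      where
      0<e : 0# < excess
      0<e = λ₁<d/2⇒0<excess h

theorem9p1 :
  (em : ExcludedMiddle 0ℓ) (R : CompleteOrderedField) (G : LocallyFiniteGraph) →
  let open CompleteOrderedField R
      open LocallyFiniteGraph G
      open Curvature em R G
  in
  (x : V) →
  let open AtVertex x in
  S₁-OutRegular →
  (2≤d : 2 ℕ.≤ d) →
  (λs : Vector ℝ d) → IsSpectrum λs →
  let λ₁ = λs (fromℕ< 2≤d) in
    ((ι d / ι 2 ≤ λ₁ ⇔ ∞-CurvatureSharp)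
     × (ι d / ι 2 ≤ λ₁ → (𝒩 : ℝ ⁺) → [ 0# ] <⁺ 𝒩 →
          IsCurvature x 𝒩 ((ι 3 + ι d - av₁⁺) / ι 2 - (ι 2 * ι d) * recip 𝒩)))
  × (λ₁ < ι d / ι 2 → (𝒩 : ℝ ⁺) → [ 0# ] <⁺ 𝒩 →
       (𝒩 ≤⁺ [ (ι 2 * ι d) / (ι d - ι 2 * λ₁) ] →
          IsCurvature x 𝒩 ((ι 3 + ι d - av₁⁺) / ι 2 - (ι 2 * ι d) * recip 𝒩))
     × ([ (ι 2 * ι d) / (ι d - ι 2 * λ₁) ] <⁺ 𝒩 →
          IsCurvature x 𝒩 ((ι 3 - ι d - av₁⁺) / ι 2 + ι 2 * λ₁)))
theorem9p1 em R G x out-regular 2≤d λs spectrum =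
  (sharp , curvature-sharp) , λ h 𝒩 0<𝒩 → curvature-low h 𝒩 0<𝒩 , curvature-high h 𝒩 0<𝒩
  where
  open VertexCurvature em R G x
  open Curvatures out-regular 2≤d λs spectrum
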